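{- There exists $m_0$ such that the following holds for every integer $m\ge m_0$. Let $\mathcal H$ be a simple $(m-1)$-uniform hypergraph on $2m$ vertices, let $C$ be a Hamiltonian Berge cycle in $\mathcal H$, and let $f\in E(\mathcal H)\setminus E(C)$. Then the subhypergraph with edge set $E(C)\cup\{f\}$ is Berge-pancyclic, i.e. it contains Berge cycles of every length $2,3,\dots,2m$.
   Context: All hypergraphs are finite and simple: the edge family consists of distinct subsets of the vertex set. A Berge cycle of length $\ell\ge 2$ is an alternating sequence $x_0h_0x_1h_1\cdots x_{\ell-1}h_{\ell-1}x_0$ with distinct vertices $x_i$, distinct hyperedges $h_i$, and $\{x_i,x_{i+1}\}\subseteq h_i$ for every $i$ (indices modulo $\ell$); its edge set is $E(C)=\{h_0,\dots,h_{\ell-1}\}$. It is Hamiltonian if it contains every vertex. An $n$-vertex hypergraph is Berge-pancyclic if it contains Berge cycles of every length $2,3,\dots,n$. The subhypergraph with a given edge set keeps the same vertex set. -}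

module Defs where

open import Level using (0ℓ)
import Data.Bool.Properties as Bool
open import Data.Fin using (Fin; toℕ)
open import Data.Fin.Properties using (any?)
open import Data.Fin.Subset using (Subset; ∣_∣) renaming (_∈_ to _∈ˢ_)
open import Data.Nat using (ℕ; suc; _≤_)
open import Data.Nat.DivMod using (_mod_)
open import Data.Product using (∃; _×_)
open import Data.Vec.Properties using (≡-dec)
open import Function.Definitions using (Injective)
open import Relation.Binary.Definitions using (DecidableEquality)
open import Relation.Binary.PropositionalEquality using (_≡_)
open import Relation.Unary using (Pred; Decidable; _∈_)

-- A simple hypergraph with vertex set Fin n. The edges form a set of
-- subsets, so no edge is repeated; decidability makes that set finite.
record Hypergraph (n : ℕ) : Set₁ where
  constructor hypergraph
  field
    Edge  : Pred (Subset n) 0ℓ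
    edge? : Decidable Edge

open Hypergraph public

Uniform : ∀ {n} → Hypergraph n → ℕ → Set
Uniform H k = ∀ {e} → e ∈ Edge H → ∣ e ∣ ≡ k

cyclicSuc : ∀ {ℓ} → Fin ℓ → Fin ℓ
cyclicSuc {suc k} i = suc (toℕ i) mod suc k

record BergeCycle {n : ℕ} (H : Hypergraph n) (ℓ : ℕ) : Set where
  field
    2≤ℓ              : 2 ≤ ℓ
    vertex           : Fin ℓ → Fin n
    edge             : Fin ℓ → Subset n
    vertex-injective : Injective _≡_ _≡_ vertex
    edge-injective   : Injective _≡_ _≡_ edge
    edge∈H           : ∀ i → edge i ∈ Edge H
    incident         : ∀ i → vertex i ∈ˢ edge i × vertex (cyclicSuc i) ∈ˢ edge i

infix 4 _≟ˢ_

_≟ˢ_ : ∀ {n} → DecidableEquality (Subset n)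
_≟ˢ_ = ≡-dec Bool._≟_

module _ {n : ℕ} {H : Hypergraph n} {ℓ : ℕ} (C : BergeCycle H ℓ) where
  open BergeCycle C

  E : Pred (Subset n) 0ℓ
  E e = ∃ λ i → edge i ≡ e

  E? : Decidable E
  E? e = any? (λ i → edge i ≟ˢ e)

  Hamiltonian : Set
  Hamiltonian = ∀ v → ∃ λ i → vertex i ≡ v

BergePancyclic : ∀ {n} → Hypergraph n → Set
BergePancyclic {n} H = ∀ ℓ → 2 ≤ ℓ → ℓ ≤ n → BergeCycle H ℓ

-- Let n = 2m, d = ℓ - 1 and e = n - d, unroll the Hamiltonian cycle as
-- … X₀ h₀ X₁ h₁ …, and suppose that there is no cycle of length ℓ.
--
-- Short cycles, 3ℓ < m.  Of any three edges two share ℓ vertices.  If h_i and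
-- h_{i+d} did, the d vertices between them would close up, so one of the two
-- shares ℓ vertices with f ("is near f").  But h_i and h_{i+d-1} cannot both be
-- near f, as f would link them around the d - 1 vertices in between.  Hence h_i
-- near implies h_{i-1} near, so all h_i are near: contradiction.
--
-- Long cycles.  f contains no two positions at distance d, hence f and its
-- translate by d cover everything but two positions.  If X_i or X_{i+1} lies in
-- f, cycles through f and h_i pair up the positions so that f and h_i never both
-- contain the two members of a pair; by cardinality h_i is then determined by f
-- up to three positions.  Bypassing X_i through h_{i-1} and h_i shows that f
-- almost avoids the distance e - 1 as well as e, so f is a union of boundedly
-- many runs.  Cycles made of two arcs joined by f and one h_x next confine f to
-- almost an interval of length about d ≈ e ≈ m, and for x slightly before that
-- interval they exclude almost every position from h_x.

module Submission where

open import Defs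
open import Data.Nat using (ℕ; _≤_; _*_; _∸_)
open import Data.Product using (∃)
open import Data.Fin.Subset using (Subset)
open import Relation.Unary using (_∈_; _∪_; _∖_; ｛_｝)
open import Relation.Unary.Properties using (_∪?_)
import Algebra.Properties.CommutativeMonoid.Sum
open import Data.Bool.Base using (Bool; true; false; not; _∧_; _∨_; T)
open import Data.Bool.Properties using (T-∧)
open import Data.Empty using (⊥; ⊥-elim)
open import Data.Fin.Base using (Fin; zero; suc; toℕ)
import Data.Fin.Properties as Fin
open import Data.Fin.Permutation using (Permutation; permutation; ↔⇒≡)
open import Data.Fin.Subset using (∣_∣) renaming (_∈_ to _∈ˢ_)
open import Data.Fin.Subset.Properties using (anySubset?; _∈?_)
open import Data.List.Base as List using (List; []; _∷_; _++_; length)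
open import Data.List.Membership.Propositional.Properties using (∈-lookup)
open import Data.List.Properties using (length-++)
open import Data.List.Relation.Unary.All as All using (All; []; _∷_)
import Data.List.Relation.Unary.All.Properties as All
open import Data.List.Relation.Unary.AllPairs using (AllPairs; []; _∷_)
import Data.List.Relation.Unary.AllPairs.Properties as AllPairs
open import Data.Nat using (zero; suc; _+_; _<_; _≤ᵇ_; z≤n; s≤s)
open import Data.Nat.DivMod using (_/_; _%_; _mod_; m<n⇒m%n≡m; n%n≡0; [m+n]%n≡m%n; [m+kn]%n≡m%n; m≡m%n+[m/n]*n)
open import Data.Nat.Properties
open import Data.Nat.Tactic.RingSolver using (solve-∀)
open import Data.Product using (_,_; _×_; proj₁; proj₂; ∃-syntax)
open import Data.Sum using (_⊎_; inj₁; inj₂)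
open import Data.Unit.Base using (⊤; tt)
open import Data.Vec.Base as Vec using (Vec; []; _∷_)
open import Data.Vec.N-ary using (N-ary; _$ⁿ_)
open import Data.Vec.Properties using (lookup⇒[]=; []=⇒lookup; lookup∘tabulate)
open import Function.Base using (case_of_)
open import Function.Definitions using (Injective)
open import Function.Bundles using (Equivalence)
open import Relation.Binary.Definitions using (tri<; tri≈; tri>)
open import Relation.Binary.PropositionalEquality
open import Relation.Nullary using (¬_; Dec; yes; no)
open import Relation.Nullary.Decidable using (decidable-stable; map′; _×-dec_; _→-dec_)

module Sum = Algebra.Properties.CommutativeMonoid.Sum +-0-commutativeMonoid
-- Linear arithmetic

-- Linear inequalities are discharged by certificates: the goal L ≤ R follows
-- from hypotheses Aᵢ ≤ Bᵢ once L + Σ kᵢBᵢ is coefficientwise at most R + Σ kᵢAᵢ.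

infixl 6 _⊕_
infixl 7 _⊗_
infix  4 _≤′_ _<′_ _≡′_
infixr 3 _·_⇒_
infix  8 #_

data Linear (k : ℕ) : Set where
  var : Fin k → Linear k
  #_  : ℕ → Linear k
  _⊕_ : Linear k → Linear k → Linear k
  _⊗_ : ℕ → Linear k → Linear k

data Claim (k : ℕ) : Set where
  _≤′_ _<′_ _≡′_ : Linear k → Linear k → Claim k
  false′ : Claim k

data Problem (k : ℕ) : Set where
  goal  : Claim k → Problem k
  _·_⇒_ : ℕ → Claim k → Problem k → Problem k

module _ {k : ℕ} where

  ⟦_⟧ : Linear k → Vec ℕ k → ℕ
  ⟦ var i ⟧ ρ = Vec.lookup ρ i
  ⟦ # c ⟧ ρ = c
  ⟦ a ⊕ b ⟧ ρ = ⟦ a ⟧ ρ + ⟦ b ⟧ ρ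
  ⟦ c ⊗ a ⟧ ρ = c * ⟦ a ⟧ ρ

  ⟦_⟧ᶜ : Claim k → Vec ℕ k → Set
  ⟦ a ≤′ b ⟧ᶜ ρ = ⟦ a ⟧ ρ ≤ ⟦ b ⟧ ρ
  ⟦ a <′ b ⟧ᶜ ρ = ⟦ a ⟧ ρ < ⟦ b ⟧ ρ
  ⟦ a ≡′ b ⟧ᶜ ρ = ⟦ a ⟧ ρ ≡ ⟦ b ⟧ ρ
  ⟦ false′ ⟧ᶜ ρ = ⊥

  ⟦_⟧ᴾ : Problem k → Vec ℕ k → Set
  ⟦ goal c ⟧ᴾ ρ = ⟦ c ⟧ᶜ ρ
  ⟦ _ · c ⇒ p ⟧ᴾ ρ = ⟦ c ⟧ᶜ ρ → ⟦ p ⟧ᴾ ρ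

unit : ∀ {k} → Fin k → Vec ℕ k
unit {suc k} zero = 1 ∷ Vec.replicate k 0
unit (suc i) = 0 ∷ unit i

-- The constant term comes first, so a normal form is evaluated by `dot` against `1 ∷ ρ`.
normal : ∀ {k} → Linear k → Vec ℕ (suc k)
normal (var i) = 0 ∷ unit i
normal {k} (# c) = c ∷ Vec.replicate k 0
normal (a ⊕ b) = Vec.zipWith _+_ (normal a) (normal b)
normal (c ⊗ a) = Vec.map (c *_) (normal a)

dot : ∀ {k} → Vec ℕ k → Vec ℕ k → ℕ
dot [] [] = 0
dot (c ∷ cs) (x ∷ xs) = c * x + dot cs xs

dot-zero : ∀ {k} (ρ : Vec ℕ k) → dot (Vec.replicate k 0) ρ ≡ 0
dot-zero [] = refl
dot-zero (x ∷ ρ) = dot-zero ρ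

dot-unit : ∀ {k} (i : Fin k) (ρ : Vec ℕ k) → dot (unit i) ρ ≡ Vec.lookup ρ i
dot-unit zero (x ∷ ρ) = trans (cong₂ _+_ (+-identityʳ x) (dot-zero ρ)) (+-identityʳ x)
dot-unit (suc i) (x ∷ ρ) = dot-unit i ρ

dot-+ : ∀ {k} (a b ρ : Vec ℕ k) → dot (Vec.zipWith _+_ a b) ρ ≡ dot a ρ + dot b ρ
dot-+ [] [] [] = refl
dot-+ (a ∷ as) (b ∷ bs) (x ∷ ρ) rewrite dot-+ as bs ρ = lemma a b x (dot as ρ) (dot bs ρ)
  where
  lemma : ∀ a b x s t → (a + b) * x + (s + t) ≡ a * x + s + (b * x + t)
  lemma = solve-∀

dot-* : ∀ {k} c (a ρ : Vec ℕ k) → dot (Vec.map (c *_) a) ρ ≡ c * dot a ρ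
dot-* c [] [] = sym (*-zeroʳ c)
dot-* c (a ∷ as) (x ∷ ρ) rewrite dot-* c as ρ = lemma c a x (dot as ρ)
  where
  lemma : ∀ c a x s → c * a * x + c * s ≡ c * (a * x + s)
  lemma = solve-∀

normal-correct : ∀ {k} (a : Linear k) ρ → dot (normal a) (1 ∷ ρ) ≡ ⟦ a ⟧ ρ
normal-correct (var i) ρ = dot-unit i ρ
normal-correct (# c) ρ = trans (cong₂ _+_ (*-identityʳ c) (dot-zero ρ)) (+-identityʳ c)
normal-correct (a ⊕ b) ρ =
  trans (dot-+ (normal a) (normal b) (1 ∷ ρ)) (cong₂ _+_ (normal-correct a ρ) (normal-correct b ρ))
normal-correct (c ⊗ a) ρ = trans (dot-* c (normal a) (1 ∷ ρ)) (cong (c *_) (normal-correct a ρ))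

_≤ᵛ_ : ∀ {k} → Vec ℕ k → Vec ℕ k → Bool
[] ≤ᵛ [] = true
(a ∷ as) ≤ᵛ (b ∷ bs) = (a ≤ᵇ b) ∧ (as ≤ᵛ bs)

dot-mono : ∀ {k} (a b ρ : Vec ℕ k) → T (a ≤ᵛ b) → dot a ρ ≤ dot b ρ
dot-mono [] [] [] _ = z≤n
dot-mono (a ∷ as) (b ∷ bs) (x ∷ ρ) t with Equivalence.to T-∧ t
... | p , q = +-mono-≤ (*-monoˡ-≤ x (≤ᵇ⇒≤ a b p)) (dot-mono as bs ρ q)

module _ {k : ℕ} where

  lower upper : Claim k → Linear k
  lower (a ≤′ b) = a
  lower (a <′ b) = # 1 ⊕ a
  lower (a ≡′ b) = a
  lower false′ = # 1
  upper (a ≤′ b) = b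
  upper (a <′ b) = b
  upper (a ≡′ b) = b
  upper false′ = # 0

  lower≤upper : ∀ c ρ → ⟦ c ⟧ᶜ ρ → ⟦ lower c ⟧ ρ ≤ ⟦ upper c ⟧ ρ
  lower≤upper (a ≤′ b) ρ p = p
  lower≤upper (a <′ b) ρ p = p
  lower≤upper (a ≡′ b) ρ p = ≤-reflexive p

  -- A goal that is an equation needs a second inequality in the opposite direction, accumulated
  -- alongside the first with the same weights. Only equations can be reversed for it; an inequality
  -- contributes the trivial claim.
  converse : Claim k → Claim k
  converse (a ≡′ b) = b ≡′ a
  converse c = # 0 ≤′ # 0

  converse-sound : ∀ c ρ → ⟦ c ⟧ᶜ ρ → ⟦ converse c ⟧ᶜ ρ
  converse-sound (a ≤′ b) ρ _ = z≤n
  converse-sound (a <′ b) ρ _ = z≤n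
  converse-sound (a ≡′ b) ρ p = sym p

  implies : Claim k → Claim k → Bool
  implies h g = normal (lower g ⊕ upper h) ≤ᵛ normal (upper g ⊕ lower h)

  implies-sound : ∀ h g ρ → T (implies h g) → ⟦ lower h ⟧ ρ ≤ ⟦ upper h ⟧ ρ →
                  ⟦ lower g ⟧ ρ ≤ ⟦ upper g ⟧ ρ
  implies-sound h g ρ t h≤ = +-cancelʳ-≤ (⟦ upper h ⟧ ρ) _ _ (≤-trans
    (subst₂ _≤_ (normal-correct (lower g ⊕ upper h) ρ) (normal-correct (upper g ⊕ lower h) ρ)
      (dot-mono (normal (lower g ⊕ upper h)) (normal (upper g ⊕ lower h)) (1 ∷ ρ) t))
    (+-monoʳ-≤ (⟦ upper g ⟧ ρ) h≤))

  proves : (h h⁻ g : Claim k) → Bool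
  proves h h⁻ (a ≡′ b) = implies h (a ≤′ b) ∧ implies h⁻ (b ≤′ a)
  proves h h⁻ g = implies h g

  proves-sound : ∀ h h⁻ g ρ → T (proves h h⁻ g) → ⟦ lower h ⟧ ρ ≤ ⟦ upper h ⟧ ρ →
                 ⟦ lower h⁻ ⟧ ρ ≤ ⟦ upper h⁻ ⟧ ρ → ⟦ g ⟧ᶜ ρ
  proves-sound h h⁻ (a ≤′ b) ρ t p q = implies-sound h (a ≤′ b) ρ t p
  proves-sound h h⁻ (a <′ b) ρ t p q = implies-sound h (a <′ b) ρ t p
  proves-sound h h⁻ (a ≡′ b) ρ t p q with Equivalence.to T-∧ t
  ... | u , v = ≤-antisym (implies-sound h (a ≤′ b) ρ u p) (implies-sound h⁻ (b ≤′ a) ρ v q)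
  proves-sound h h⁻ false′ ρ t p q with implies-sound h false′ ρ t p
  ... | ()

  _⊞_·_ : Claim k → ℕ → Claim k → Claim k
  h ⊞ w · c = (lower h ⊕ w ⊗ lower c) ≤′ (upper h ⊕ w ⊗ upper c)

  valid : (h h⁻ : Claim k) → Problem k → Bool
  valid h h⁻ (goal g) = proves h h⁻ g
  valid h h⁻ (w · c ⇒ p) = valid (h ⊞ w · c) (h⁻ ⊞ w · converse c) p

  valid-sound : ∀ h h⁻ p ρ → T (valid h h⁻ p) → ⟦ lower h ⟧ ρ ≤ ⟦ upper h ⟧ ρ →
                ⟦ lower h⁻ ⟧ ρ ≤ ⟦ upper h⁻ ⟧ ρ → ⟦ p ⟧ᴾ ρ
  valid-sound h h⁻ (goal g) ρ t p q = proves-sound h h⁻ g ρ t p q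
  valid-sound h h⁻ (w · c ⇒ pr) ρ t p q x =
    valid-sound (h ⊞ w · c) (h⁻ ⊞ w · converse c) pr ρ t
      (+-mono-≤ p (*-monoʳ-≤ w (lower≤upper c ρ x)))
      (+-mono-≤ q (*-monoʳ-≤ w (lower≤upper (converse c) ρ (converse-sound c ρ x))))

-- Abstract, so that no certificate is ever unfolded when a later proof is normalised.
abstract
  linear : ∀ {k} (ρ : Vec ℕ k) (f : N-ary k (Linear k) (Problem k))
           {_ : T (valid (# 0 ≤′ # 0) (# 0 ≤′ # 0) (f $ⁿ Vec.map var (Vec.allFin k)))} →
           ⟦ f $ⁿ Vec.map var (Vec.allFin k) ⟧ᴾ ρ
  linear ρ f {t} = valid-sound (# 0 ≤′ # 0) (# 0 ≤′ # 0) (f $ⁿ Vec.map var (Vec.allFin _)) ρ t z≤n z≤n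

-- Counting

ι : Bool → ℕ
ι true = 1
ι false = 0

∑ : (ℕ → ℕ) → ℕ → ℕ → ℕ
∑ p a zero = 0
∑ p a (suc k) = p a + ∑ p (suc a) k

tail-bound : ∀ {a k x} → suc a ≤ x → x < suc a + k → a ≤ x × x < a + suc k
tail-bound {a} {k} {x} l u =
  linear (a ∷ x ∷ []) (λ a x → 1 · # 1 ⊕ a ≤′ x ⇒ goal (a ≤′ x)) l ,
  linear (a ∷ k ∷ x ∷ []) (λ a k x → 1 · x <′ # 1 ⊕ a ⊕ k ⇒ goal (x <′ a ⊕ (# 1 ⊕ k))) u

head-bound : ∀ {a k} → a < a + suc k
head-bound {a} {k} = linear (a ∷ k ∷ []) (λ a k → goal (a <′ a ⊕ (# 1 ⊕ k)))

∑-mono : ∀ {p q} a k → (∀ {x} → a ≤ x → x < a + k → p x ≤ q x) → ∑ p a k ≤ ∑ q a k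
∑-mono a zero h = z≤n
∑-mono a (suc k) h = +-mono-≤ (h ≤-refl head-bound)
  (∑-mono (suc a) k λ l u → let l′ , u′ = tail-bound l u in h l′ u′)

∑-cong : ∀ {p q} a k → (∀ {x} → a ≤ x → x < a + k → p x ≡ q x) → ∑ p a k ≡ ∑ q a k
∑-cong a k h = ≤-antisym (∑-mono a k λ l u → ≤-reflexive (h l u))
                         (∑-mono a k λ l u → ≤-reflexive (sym (h l u)))

∑-+ : ∀ p q a k → ∑ (λ x → p x + q x) a k ≡ ∑ p a k + ∑ q a k
∑-+ p q a zero = refl
∑-+ p q a (suc k) rewrite ∑-+ p q (suc a) k =
  linear (p a ∷ q a ∷ ∑ p (suc a) k ∷ ∑ q (suc a) k ∷ [])
    (λ x y s t → goal (x ⊕ y ⊕ (s ⊕ t) ≡′ x ⊕ s ⊕ (y ⊕ t)))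

∑-split : ∀ p a k l → ∑ p a (k + l) ≡ ∑ p a k + ∑ p (a + k) l
∑-split p a zero l = cong (λ x → ∑ p x l) (sym (+-identityʳ a))
∑-split p a (suc k) l rewrite ∑-split p (suc a) k l | +-suc a k = sym (+-assoc (p a) _ _)

∑-shift : ∀ p c a k → ∑ (λ x → p (x + c)) a k ≡ ∑ p (a + c) k
∑-shift p c a zero = refl
∑-shift p c a (suc k) = cong (p (a + c) +_) (∑-shift p c (suc a) k)

∑-const : ∀ c a k → ∑ (λ _ → c) a k ≡ k * c
∑-const c a zero = refl
∑-const c a (suc k) = cong (c +_) (∑-const c (suc a) k)

∑-prefix : ∀ p a {k l} → k ≤ l → ∑ p a k ≤ ∑ p a l
∑-prefix p a {l = l} z≤n = z≤n
∑-prefix p a (s≤s k≤l) = +-monoʳ-≤ (p a) (∑-prefix p (suc a) k≤l)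

-- Moving a full window one step drops `p a` and gains the equal term `p (a + n)`.
∑-periodic : ∀ p n → (∀ x → p (x + n) ≡ p x) → ∀ a b → ∑ p a n ≡ ∑ p b n
∑-periodic p n per a b = trans (from-zero a) (sym (from-zero b))
  where
  last : ∀ a k → ∑ p a (suc k) ≡ ∑ p a k + p (a + k)
  last a k = trans (cong (∑ p a) (+-comm 1 k))
    (trans (∑-split p a k 1) (cong (∑ p a k +_) (+-identityʳ _)))
  step : ∀ a → ∑ p (suc a) n ≡ ∑ p a n
  step a = +-cancelˡ-≡ (p a) _ _ (trans (last a n)
    (trans (cong (∑ p a n +_) (per a)) (+-comm (∑ p a n) (p a))))
  from-zero : ∀ a → ∑ p a n ≡ ∑ p 0 n
  from-zero zero = refl
  from-zero (suc a) = trans (step a) (from-zero a)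

#[_] : (ℕ → Bool) → ℕ → ℕ → ℕ
#[ b ] = ∑ (λ x → ι (b x))

ι≤1 : ∀ b → ι b ≤ 1
ι≤1 true = ≤-refl
ι≤1 false = z≤n

count≤length : ∀ b a k → #[ b ] a k ≤ k
count≤length b a k = ≤-trans (∑-mono {q = λ _ → 1} a k λ {x} _ _ → ι≤1 (b x))
  (≤-reflexive (trans (∑-const 1 a k) (*-identityʳ k)))

count-not : ∀ b a k → #[ b ] a k + #[ (λ x → not (b x)) ] a k ≡ k
count-not b a k = trans (sym (∑-+ _ _ a k))
  (trans (∑-cong a k λ {x} _ _ → complement (b x)) (trans (∑-const 1 a k) (*-identityʳ k)))
  where
  complement : ∀ b → ι b + ι (not b) ≡ 1
  complement true = refl
  complement false = refl

member : ∀ b a k → 1 ≤ #[ b ] a k → ∃[ x ] (a ≤ x × x < a + k × b x ≡ true)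
member b a (suc k) h with b a in eq
... | true = a , ≤-refl , head-bound , eq
... | false with member b (suc a) k h
... | x , l , u , bx = let l′ , u′ = tail-bound l u in x , l′ , u′ , bx

non-member : ∀ b a k → #[ b ] a k < k → ∃[ x ] (a ≤ x × x < a + k × b x ≡ false)
non-member b a k h with member (λ x → not (b x)) a k
  (linear (#[ b ] a k ∷ #[ (λ x → not (b x)) ] a k ∷ k ∷ [])
    (λ s t k → 1 · k ≡′ s ⊕ t ⇒ 1 · s <′ k ⇒ goal (# 1 ≤′ t)) (sym (count-not b a k)) h)
... | x , l , u , nb = x , l , u , not-true nb
  where
  not-true : ∀ {b} → not b ≡ true → b ≡ false
  not-true {false} refl = refl

none⇒count≡0 : ∀ b a k → (∀ {x} → a ≤ x → x < a + k → b x ≡ true → ⊥) → #[ b ] a k ≡ 0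
none⇒count≡0 b a k h = trans (∑-cong {q = λ _ → 0} a k λ {x} l u → zero-bit (b x) (h l u))
  (trans (∑-const 0 a k) (*-zeroʳ k))
  where
  zero-bit : ∀ b → (b ≡ true → ⊥) → ι b ≡ 0
  zero-bit true n = ⊥-elim (n refl)
  zero-bit false n = refl

nor : Bool → Bool → Bool
nor a b = not a ∧ not b

disjoint-nor : ∀ a b → (a ≡ true → b ≡ true → ⊥) → ι (nor a b) + ι a + ι b ≡ 1
disjoint-nor true true h = ⊥-elim (h refl refl)
disjoint-nor true false h = refl
disjoint-nor false true h = refl
disjoint-nor false false h = refl

-- Turns an exclusion between two sets into an exact count of the positions that both miss.
count-nor : ∀ (p q : ℕ → Bool) a k → (∀ {x} → a ≤ x → x < a + k → p x ≡ true → q x ≡ true → ⊥) →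
  #[ (λ x → nor (p x) (q x)) ] a k + #[ p ] a k + #[ q ] a k ≡ k
count-nor p q a k h =
  trans (cong (_+ #[ q ] a k) (sym (∑-+ (λ x → ι (nor (p x) (q x))) _ a k))) (trans (sym (∑-+ (λ x → ι (nor (p x) (q x)) + ι (p x)) _ a k))
    (trans (∑-cong a k λ {x} l u → disjoint-nor (p x) (q x) (h l u))
      (trans (∑-const 1 a k) (*-identityʳ k))))

-- Two families of incompatible pairs (η x , φ (x + a)) and (φ x , η (x + b))
-- use up every position, so the two cardinalities determine how many pairs
-- are missed by both sets.
deficit : ∀ (φ η : ℕ → Bool) W a b M → φ W ≡ true → φ (W + a) ≡ false →
  #[ φ ] W (a + suc b) ≡ M → #[ η ] W (a + suc b) ≡ M →
  (∀ {x} → W ≤ x → x < W + suc b → η x ≡ true → φ (x + a) ≡ true → ⊥) →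
  (∀ {x} → suc W ≤ x → x < suc W + a → φ x ≡ true → η (x + b) ≡ true → ⊥) →
  #[ (λ x → nor (η x) (φ (x + a))) ] W (suc b) +
  #[ (λ x → nor (φ x) (η (x + b))) ] (suc W) a + (M + M) ≡ suc (a + suc b)
deficit φ η W a b M φW φWa ∑φ ∑η e₁ e₂ =
  linear (D₁ ∷ D₂ ∷ M ∷ a ∷ b ∷ #[ η ] W (suc b) ∷ #[ (λ x → φ (x + a)) ] W (suc b) ∷
          #[ φ ] (suc W) a ∷ #[ (λ x → η (x + b)) ] (suc W) a ∷ [])
    (λ D₁ D₂ M a b h₁ f₁ f₂ h₂ →
      1 · D₁ ⊕ h₁ ⊕ f₁ ≡′ # 1 ⊕ b ⇒ 1 · D₂ ⊕ f₂ ⊕ h₂ ≡′ a ⇒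
      1 · M ≡′ h₁ ⊕ h₂ ⇒ 1 · M ≡′ # 1 ⊕ (f₂ ⊕ f₁) ⇒
      goal (D₁ ⊕ D₂ ⊕ (M ⊕ M) ≡′ # 1 ⊕ (a ⊕ (# 1 ⊕ b))))
    (count-nor η _ W (suc b) e₁) (count-nor φ _ (suc W) a e₂) η-total φ-total
  where
  D₁ = #[ (λ x → nor (η x) (φ (x + a))) ] W (suc b)
  D₂ = #[ (λ x → nor (φ x) (η (x + b))) ] (suc W) a
  η-total : M ≡ #[ η ] W (suc b) + #[ (λ x → η (x + b)) ] (suc W) a
  η-total = trans (sym ∑η) (trans (cong (#[ η ] W) (+-comm a (suc b)))
    (trans (∑-split _ W (suc b) a) (cong (#[ η ] W (suc b) +_)
      (trans (cong (λ y → #[ η ] y a) (+-suc W b)) (sym (∑-shift (λ x → ι (η x)) b (suc W) a))))))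
  φ-total : M ≡ 1 + (#[ φ ] (suc W) a + #[ (λ x → φ (x + a)) ] W (suc b))
  φ-total = trans (sym ∑φ) (trans (cong (#[ φ ] W) (+-suc a b))
    (cong₂ _+_ (cong ι φW) (trans (∑-split _ (suc W) a b) (cong (#[ φ ] (suc W) a +_)
      (trans (sym (∑-shift (λ x → ι (φ x)) a (suc W) b))
        -- Since `W + a` is not in `φ`, the translated window may start one position earlier.
        (cong (λ y → ι y + #[ (λ x → φ (x + a)) ] (suc W) b) (sym φWa)))))))

∑-suc : ∀ p a k → ∑ (λ x → p (suc x)) a k ≡ ∑ p (suc a) k
∑-suc p a zero = refl
∑-suc p a (suc k) = cong (p (suc a) +_) (∑-suc p (suc a) k)

-- Cycles from closed walks

data Label : Set where
  rim   : ℕ → Label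
  chord : Label

rim-injective : ∀ {i j} → rim i ≡ rim j → i ≡ j
rim-injective refl = refl

-- A Hamiltonian Berge cycle h₀, h₁, … unrolled along ℕ, with an additional edge f.
record Unrolled {n : ℕ} (H : Hypergraph n) : Set where
  field
    X : ℕ → Fin n
    h : ℕ → Subset n
    f : Subset n
    X-periodic : ∀ i → X (i + n) ≡ X i
    h-periodic : ∀ i → h (i + n) ≡ h i
    X-distinct : ∀ {i j} → i < j → j < i + n → X i ≢ X j
    h-distinct : ∀ {i j} → i < j → j < i + n → h i ≢ h j
    h≢f : ∀ i → h i ≢ f
    left∈h : ∀ i → X i ∈ˢ h i
    right∈h : ∀ i → X (suc i) ∈ˢ h i
    h∈H : ∀ i → h i ∈ Edge H
    f∈H : f ∈ Edge H

module Cycles {n : ℕ} {H : Hypergraph n} (U : Unrolled H) where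
  open Unrolled U

  edgeOf : Label → Subset n
  edgeOf (rim i) = h i
  edgeOf chord = f

  edgeOf∈H : ∀ g → edgeOf g ∈ Edge H
  edgeOf∈H (rim i) = h∈H i
  edgeOf∈H chord = f∈H

  on : Label → ℕ → Bool
  on g x = Vec.lookup (edgeOf g) (X x)

  -- Each entry is a position together with the label of the edge leading to the next one.
  Steps : Set
  Steps = List (ℕ × Label)

  data Walk : ℕ → Steps → ℕ → Set where
    stop : ∀ {v} → Walk v [] v
    step : ∀ {v u w g xs} → on g v ≡ true → on g u ≡ true → Walk u xs w → Walk v ((v , g) ∷ xs) w

  infixr 5 _⋯_
  _⋯_ : ∀ {u v w xs ys} → Walk u xs v → Walk v ys w → Walk u (xs ++ ys) w
  stop ⋯ q = q
  step a b p ⋯ q = step a b (p ⋯ q)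

  Apart Apartᴴ : ℕ × Label → ℕ × Label → Set
  Apart (i , g) (j , g′) = i ≢ j × g ≢ g′
  Apartᴴ (i , g) (j , g′) = X i ≢ X j × edgeOf g ≢ edgeOf g′

  Between : ℕ → ℕ → Label → Set
  Between lo hi (rim i) = lo ≤ i × i < hi
  Between lo hi chord = ⊤

  -- Within one period, different numbers stand for different vertices and edges, so distinctness
  -- can be checked on numbers alone.
  InWindow : ℕ → ℕ × Label → Set
  InWindow b (i , g) = (b ≤ i × i < b + n) × Between b (b + n) g

  window-distinct : ∀ {A : Set} (Y : ℕ → A) → (∀ {i j} → i < j → j < i + n → Y i ≢ Y j) →
    ∀ {b i j} → b ≤ i → i < b + n → b ≤ j → j < b + n → i ≢ j → Y i ≢ Y j
  window-distinct Y distinct {b} {i} {j} bi ib bj jb i≢j Yij with <-cmp i j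
  ... | tri< i<j _ _ = distinct i<j (linear (b ∷ i ∷ j ∷ n ∷ [])
          (λ b i j n → 1 · b ≤′ i ⇒ 1 · j <′ b ⊕ n ⇒ goal (j <′ i ⊕ n)) bi jb) Yij
  ... | tri≈ _ i≡j _ = i≢j i≡j
  ... | tri> _ _ j<i = distinct j<i (linear (b ∷ i ∷ j ∷ n ∷ [])
          (λ b i j n → 1 · b ≤′ j ⇒ 1 · i <′ b ⊕ n ⇒ goal (i <′ j ⊕ n)) bj ib) (sym Yij)

  edgeOf-distinct : ∀ {b} g g′ → Between b (b + n) g → Between b (b + n) g′ → g ≢ g′ →
                    edgeOf g ≢ edgeOf g′
  edgeOf-distinct (rim i) (rim j) (l , u) (l′ , u′) i≢j =
    window-distinct h h-distinct l u l′ u′ (λ i≡j → i≢j (cong rim i≡j))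
  edgeOf-distinct (rim i) chord _ _ _ = h≢f i
  edgeOf-distinct chord (rim j) _ _ _ = λ e → h≢f j (sym e)
  edgeOf-distinct chord chord _ _ c≢c = λ _ → c≢c refl

  apart-in-window : ∀ {b} xs → All (InWindow b) xs → AllPairs Apart xs → AllPairs Apartᴴ xs
  apart-in-window [] [] [] = []
  apart-in-window ((i , g) ∷ xs) (((l , u) , r) ∷ ws) (ap ∷ aps) =
    head ws ap ∷ apart-in-window xs ws aps
    where
    head : ∀ {ys} → All (InWindow _) ys → All (Apart (i , g)) ys → All (Apartᴴ (i , g)) ys
    head [] [] = []
    head {(j , g′) ∷ _} (((l′ , u′) , r′) ∷ ws) ((i≢j , g≢g′) ∷ as) =
      (window-distinct X X-distinct l u l′ u′ i≢j , edgeOf-distinct g g′ r r′ g≢g′) ∷ head ws as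

  apart-lookup : ∀ {xs} → AllPairs Apartᴴ xs → ∀ i j → i ≢ j →
    X (proj₁ (List.lookup xs i)) ≢ X (proj₁ (List.lookup xs j)) ×
    edgeOf (proj₂ (List.lookup xs i)) ≢ edgeOf (proj₂ (List.lookup xs j))
  apart-lookup (a ∷ as) zero zero i≢j = ⊥-elim (i≢j refl)
  apart-lookup (a ∷ as) zero (suc j) _ = All.lookup a (∈-lookup j)
  apart-lookup (a ∷ as) (suc i) zero _ with All.lookup a (∈-lookup i)
  ... | v , e = (λ q → v (sym q)) , (λ q → e (sym q))
  apart-lookup (a ∷ as) (suc i) (suc j) i≢j = apart-lookup as i j (λ e → i≢j (cong suc e))

  on⇒∈ : ∀ {g x} → on g x ≡ true → X x ∈ˢ edgeOf g
  on⇒∈ {g} {x} = lookup⇒[]= (X x) (edgeOf g)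

  ∈⇒on : ∀ {g x} → X x ∈ˢ edgeOf g → on g x ≡ true
  ∈⇒on = []=⇒lookup

  start : ∀ {v w g i xs} → Walk v ((i , g) ∷ xs) w → v ≡ i
  start (step _ _ _) = refl

  here-on : ∀ {v w xs} → Walk v xs w → ∀ i → let (x , g) = List.lookup xs i in on g x ≡ true
  here-on (step a _ _) zero = a
  here-on (step _ _ p) (suc i) = here-on p i

  next-on : ∀ {v w xs} → Walk v xs w → ∀ i j → toℕ j ≡ suc (toℕ i) →
    on (proj₂ (List.lookup xs i)) (proj₁ (List.lookup xs j)) ≡ true
  next-on (step _ b p@(step _ _ _)) zero (suc zero) _ = b
  next-on (step _ _ p) (suc i) (suc j) e = next-on p i j (suc-injective e)

  last-on : ∀ {v w xs} → Walk v xs w → ∀ i → suc (toℕ i) ≡ length xs →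
    on (proj₂ (List.lookup xs i)) w ≡ true
  last-on (step _ b stop) zero _ = b
  last-on (step _ _ p) (suc i) e = last-on p i (suc-injective e)

  closed-walk : ∀ {b v w xs} → Walk v xs w → X v ≡ X w → 2 ≤ length xs →
    All (InWindow b) xs → AllPairs Apart xs → BergeCycle H (length xs)
  closed-walk {xs = xs@((v , g) ∷ _)} p Xv≡Xw 2≤ ws as = record
    { 2≤ℓ = 2≤
    ; vertex = vertex
    ; edge = edge
    ; vertex-injective = λ {i} {j} e → injective i j λ i≢j → proj₁ (apart-lookup apart i j i≢j) e
    ; edge-injective = λ {i} {j} e → injective i j λ i≢j → proj₂ (apart-lookup apart i j i≢j) e
    ; edge∈H = λ i → edgeOf∈H (proj₂ (List.lookup xs i))
    ; incident = λ i → on⇒∈ {proj₂ (List.lookup xs i)} (here-on p i) , next i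
    }
    where
    vertex : Fin (length xs) → Fin n
    vertex i = X (proj₁ (List.lookup xs i))
    edge : Fin (length xs) → Subset n
    edge i = edgeOf (proj₂ (List.lookup xs i))
    apart = apart-in-window xs ws as
    injective : ∀ (i j : Fin (length xs)) → ¬ (i ≢ j) → i ≡ j
    injective i j = decidable-stable (i Fin.≟ j)
    next : ∀ i → vertex (cyclicSuc i) ∈ˢ edge i
    next i with m≤n⇒m<n∨m≡n (Fin.toℕ<n i)
    ... | inj₁ i<ℓ = on⇒∈ {proj₂ (List.lookup xs i)} (next-on p i (cyclicSuc i)
            (trans (Fin.toℕ-fromℕ< _) (m<n⇒m%n≡m i<ℓ)))
    -- After the last index the cyclic successor is 0, and the walk ends at the vertex where it
    -- began.
    ... | inj₂ i≡ℓ = subst (_∈ˢ edge i) (trans (sym Xv≡Xw) (trans (cong X (start p)) (cong vertex (sym first))))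
            (on⇒∈ {proj₂ (List.lookup xs i)} (last-on p i i≡ℓ))
      where
      first : cyclicSuc i ≡ zero
      first = Fin.toℕ-injective (trans (Fin.toℕ-fromℕ< _)
        (trans (cong (_% length xs) i≡ℓ) (n%n≡0 (length xs))))

  -- Cycles assembled from arcs of the rim

  up down : ℕ → ℕ → Steps
  up p zero = []
  up p (suc k) = (p , rim p) ∷ up (suc p) k
  down p zero = []
  down p (suc k) = (p + suc k , rim (p + k)) ∷ down p k

  up-walk : ∀ p k → Walk p (up p k) (p + k)
  up-walk p zero rewrite +-identityʳ p = stop
  up-walk p (suc k) rewrite +-suc p k =
    step (∈⇒on {rim p} (left∈h p)) (∈⇒on {rim p} (right∈h p)) (up-walk (suc p) k)

  down-walk : ∀ p k → Walk (p + k) (down p k) p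
  down-walk p zero rewrite +-identityʳ p = stop
  down-walk p (suc k) =
    step (subst (λ y → on (rim (p + k)) y ≡ true) (sym (+-suc p k)) (∈⇒on {rim (p + k)} (right∈h (p + k))))
      (∈⇒on {rim (p + k)} (left∈h (p + k))) (down-walk p k)

  length-up : ∀ p k → length (up p k) ≡ k
  length-up p zero = refl
  length-up p (suc k) = cong suc (length-up (suc p) k)

  length-down : ∀ p k → length (down p k) ≡ k
  length-down p zero = refl
  length-down p (suc k) = cong suc (length-down p k)

  all-up : ∀ {P : ℕ × Label → Set} p k → (∀ {i} → p ≤ i → i < p + k → P (i , rim i)) → All P (up p k)
  all-up p zero Pi = []
  all-up p (suc k) Pi = Pi ≤-refl head-bound ∷
    all-up (suc p) k λ l u → let l′ , u′ = tail-bound l u in Pi l′ u′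

  all-down : ∀ {P : ℕ × Label → Set} p k →
    (∀ {i} → p ≤ i → i < p + k → P (suc i , rim i)) → All P (down p k)
  all-down p zero Pi = []
  all-down {P} p (suc k) Pi =
    subst (λ y → P (y , rim (p + k))) (sym (+-suc p k))
      (Pi (m≤m+n p k) (≤-reflexive (sym (+-suc p k)))) ∷
    all-down p k λ l u → Pi l (<-≤-trans u (+-monoʳ-≤ p (n≤1+n k)))

  apart-up : ∀ p k → AllPairs Apart (up p k)
  apart-up p zero = []
  apart-up p (suc k) =
    all-up (suc p) k (λ l _ → <⇒≢ l , λ e → <⇒≢ l (rim-injective e)) ∷ apart-up (suc p) k

  apart-down : ∀ p k → AllPairs Apart (down p k)
  apart-down p zero = []
  apart-down p (suc k) =
    all-down p k (λ {i} _ u → >⇒≢ (subst (suc i <_) (sym (+-suc p k)) (s≤s u)) ,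
                              (λ e → >⇒≢ u (rim-injective e)))
    ∷ apart-down p k

  Beyond : ℕ → ℕ → Label → ℕ × Label → Set
  Beyond p a g₁ (i , g) = (p + a < i × i < p + n) × Between (p + a) (p + n) g × g ≢ g₁

  Between-weaken : ∀ {lo lo′ hi} g → lo ≤ lo′ → Between lo′ hi g → Between lo hi g
  Between-weaken (rim i) l (l′ , u) = ≤-trans l l′ , u
  Between-weaken chord l _ = tt

  -- The ascending arc uses only rim edges of index below `p + a`, and all that follows lies at or
  -- above `p + a` within one period. Hence repetitions have to be excluded only among the later
  -- entries.
  arc-cycle : ∀ p a g₁ {w ys} → Between (p + a) (p + n) g₁ → p + a < p + n → 1 ≤ length ys →
    Walk (p + a) ((p + a , g₁) ∷ ys) w → X p ≡ X w →
    AllPairs Apart ys → All (Beyond p a g₁) ys → BergeCycle H (a + suc (length ys))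
  arc-cycle p a g₁ {w} {ys} g₁-free p+a<p+n 1≤ walk Xp≡Xw apart beyond =
    subst (BergeCycle H) len (closed-walk {b = p} (up-walk p a ⋯ walk) Xp≡Xw
      (subst (2 ≤_) (sym len) (≤-trans (s≤s 1≤) (m≤n+m (suc (length ys)) a)))
      (All.++⁺ up-window (((m≤m+n p a , p+a<p+n) , Between-weaken g₁ (m≤m+n p a) g₁-free) ∷
        All.map beyond-window beyond))
      (AllPairs.++⁺ (apart-up p a) (All.map beyond-apart beyond ∷ apart) up-apart))
    where
    len : length (up p a ++ (p + a , g₁) ∷ ys) ≡ a + suc (length ys)
    len = trans (length-++ (up p a)) (cong (_+ suc (length ys)) (length-up p a))
    up-window : All (InWindow p) (up p a)
    up-window = all-up p a λ l u → let u′ = <-trans u p+a<p+n in (l , u′) , (l , u′)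
    beyond-window : ∀ {x} → Beyond p a g₁ x → InWindow p x
    beyond-window {i , g} ((l , u) , b , _) =
      (≤-trans (m≤m+n p a) (<⇒≤ l) , u) , Between-weaken g (m≤m+n p a) b
    beyond-apart : ∀ {x} → Beyond p a g₁ x → Apart (p + a , g₁) x
    beyond-apart ((l , _) , _ , g≢g₁) = <⇒≢ l , λ e → g≢g₁ (sym e)
    rim-apart : ∀ {i} g → i < p + a → Between (p + a) (p + n) g → rim i ≢ g
    rim-apart (rim j) u (l , _) refl = <⇒≱ u l
    up-apart : All (λ x → All (Apart x) ((p + a , g₁) ∷ ys)) (up p a)
    up-apart = all-up p a λ l u → (<⇒≢ u , rim-apart g₁ u g₁-free) ∷
      All.map (λ { {j , g} ((l′ , _) , b , _) → <⇒≢ (<-trans u l′) , rim-apart g u b }) beyond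

  -- A label that is not used by the arcs [p , p + a] and [s , s + b].
  Spare : (p a s b : ℕ) → Label → Set
  Spare p a s b chord = ⊤
  Spare p a s b (rim x) = (p + a ≤ x × x < s) ⊎ (s + b ≤ x × x < p + n)

  module _ {p a s b : ℕ} (p+a<s : p + a < s) (s+b<p+n : s + b < p + n) where

    private
      p+a<p+n : p + a < p + n
      p+a<p+n = <-trans p+a<s (≤-<-trans (m≤m+n s b) s+b<p+n)

    spare⇒between : ∀ g → Spare p a s b g → Between (p + a) (p + n) g
    spare⇒between chord _ = tt
    spare⇒between (rim x) (inj₁ (l , u)) = l , <-trans u (≤-<-trans (m≤m+n s b) s+b<p+n)
    spare⇒between (rim x) (inj₂ (l , u)) = ≤-trans (<⇒≤ p+a<s) (≤-trans (m≤m+n s b) l) , u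

    spare-apart : ∀ g {i} → Spare p a s b g → s ≤ i → i < s + b → rim i ≢ g
    spare-apart (rim x) (inj₁ (_ , x<s)) l u refl = <⇒≱ x<s l
    spare-apart (rim x) (inj₂ (s+b≤x , _)) l u refl = <⇒≱ u s+b≤x

    -- p ⋯ p+a —g₁— s ⋯ s+b —g₂— p
    parallel-cycle : ∀ g₁ g₂ → Spare p a s b g₁ → Spare p a s b g₂ → g₁ ≢ g₂ →
      on g₁ (p + a) ≡ true → on g₁ s ≡ true → on g₂ (s + b) ≡ true → on g₂ p ≡ true →
      BergeCycle H (2 + a + b)
    parallel-cycle g₁ g₂ sp₁ sp₂ g₁≢g₂ o₁ o₂ o₃ o₄ =
      subst (BergeCycle H) len (arc-cycle p a g₁ (spare⇒between g₁ sp₁) p+a<p+n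
        (subst (1 ≤_) (sym len′) (s≤s z≤n))
        (step o₁ o₂ (up-walk s b ⋯ step o₃ o₄ stop)) refl
        (AllPairs.++⁺ (apart-up s b) ([] ∷ [])
          (all-up s b λ l u → (<⇒≢ u , spare-apart g₂ sp₂ l u) ∷ []))
        (All.++⁺ (all-up s b λ l u →
            (<-≤-trans p+a<s l , <-trans u s+b<p+n) ,
            (≤-trans (<⇒≤ p+a<s) l , <-trans u s+b<p+n) , spare-apart g₁ sp₁ l u)
          (((<-≤-trans p+a<s (m≤m+n s b) , s+b<p+n) , spare⇒between g₂ sp₂ , λ e → g₁≢g₂ (sym e)) ∷ [])))
      where
      len′ : length (up s b ++ (s + b , g₂) ∷ []) ≡ suc b
      len′ = trans (length-++ (up s b)) (trans (cong (_+ 1) (length-up s b)) (+-comm b 1))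
      len : a + suc (length (up s b ++ (s + b , g₂) ∷ [])) ≡ 2 + a + b
      len = trans (cong (λ y → a + suc y) len′)
        (linear (a ∷ b ∷ []) (λ a b → goal (a ⊕ (# 2 ⊕ b) ≡′ # 2 ⊕ a ⊕ b)))

    -- p ⋯ p+a —g₁— s+b ⋯ s —g₂— p
    crossing-cycle : ∀ g₁ g₂ → Spare p a s b g₁ → Spare p a s b g₂ → g₁ ≢ g₂ →
      on g₁ (p + a) ≡ true → on g₁ (s + b) ≡ true → on g₂ s ≡ true → on g₂ p ≡ true →
      BergeCycle H (2 + a + b)
    crossing-cycle g₁ g₂ sp₁ sp₂ g₁≢g₂ o₁ o₂ o₃ o₄ =
      subst (BergeCycle H) len (arc-cycle p a g₁ (spare⇒between g₁ sp₁) p+a<p+n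
        (subst (1 ≤_) (sym len′) (s≤s z≤n))
        (step o₁ o₂ (down-walk s b ⋯ step o₃ o₄ stop)) refl
        (AllPairs.++⁺ (apart-down s b) ([] ∷ [])
          (all-down s b λ l u → (>⇒≢ (s≤s l) , spare-apart g₂ sp₂ l u) ∷ []))
        (All.++⁺ (all-down s b λ l u →
            (<-≤-trans p+a<s (m≤n⇒m≤1+n l) , ≤-<-trans u s+b<p+n) ,
            (≤-trans (<⇒≤ p+a<s) l , <-trans u s+b<p+n) , spare-apart g₁ sp₁ l u)
          (((p+a<s , ≤-<-trans (m≤m+n s b) s+b<p+n) , spare⇒between g₂ sp₂ , λ e → g₁≢g₂ (sym e)) ∷ [])))
      where
      len′ : length (down s b ++ (s , g₂) ∷ []) ≡ suc b
      len′ = trans (length-++ (down s b)) (trans (cong (_+ 1) (length-down s b)) (+-comm b 1))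
      len : a + suc (length (down s b ++ (s , g₂) ∷ [])) ≡ 2 + a + b
      len = trans (cong (λ y → a + suc y) len′)
        (linear (a ∷ b ∷ []) (λ a b → goal (a ⊕ (# 2 ⊕ b) ≡′ # 2 ⊕ a ⊕ b)))

  -- p ⋯ p+a —g₁— z₁ —g₂— z₂ —g₃— p
  two-point-cycle : ∀ p a g₁ g₂ g₃ {z₁ z₂} → p + a < z₁ → z₁ < p + n → p + a < z₂ → z₂ < p + n →
    z₁ ≢ z₂ → Between (p + a) (p + n) g₁ → Between (p + a) (p + n) g₂ → Between (p + a) (p + n) g₃ →
    g₂ ≢ g₁ → g₃ ≢ g₁ → g₂ ≢ g₃ →
    on g₁ (p + a) ≡ true → on g₁ z₁ ≡ true → on g₂ z₁ ≡ true → on g₂ z₂ ≡ true →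
    on g₃ z₂ ≡ true → on g₃ p ≡ true → BergeCycle H (a + 3)
  two-point-cycle p a g₁ g₂ g₃ l₁ u₁ l₂ u₂ z₁≢z₂ b₁ b₂ b₃ g₂≢g₁ g₃≢g₁ g₂≢g₃ o₁ o₂ o₃ o₄ o₅ o₆ =
    arc-cycle p a g₁ b₁ (<-trans l₁ u₁) (s≤s z≤n) (step o₁ o₂ (step o₃ o₄ (step o₅ o₆ stop))) refl
      (((z₁≢z₂ , g₂≢g₃) ∷ []) ∷ [] ∷ [])
      (((l₁ , u₁) , b₂ , g₂≢g₁) ∷ ((l₂ , u₂) , b₃ , g₃≢g₁) ∷ [])

-- Consequences of the absence of an ℓ-cycle, ℓ = d + 1

module NoCycle {n : ℕ} {H : Hypergraph n} (U : Unrolled H) (M : ℕ) (n≡2M+2 : n ≡ 2 + M + M)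
  (size : ∀ g → #[ Cycles.on U g ] 0 n ≡ M)
  (d′ e′ : ℕ) (n≡d+e : n ≡ suc d′ + suc e′) (no-cycle : ¬ BergeCycle H (2 + d′)) where
  open Unrolled U
  open Cycles U

  d e : ℕ
  d = suc d′
  e = suc e′

  F : ℕ → Bool
  F = on chord

  at : ∀ {g x y} → x ≡ y → on g x ≡ true → on g y ≡ true
  at {g} x≡y = subst (λ z → on g z ≡ true) x≡y

  on-periodic : ∀ g x → on g (x + n) ≡ on g x
  on-periodic g x = cong (Vec.lookup (edgeOf g)) (X-periodic x)

  rim-periodic : ∀ i x → on (rim (i + n)) x ≡ on (rim i) x
  rim-periodic i x = cong (λ s → Vec.lookup s (X x)) (h-periodic i)

  lap : ∀ {g x} → on g x ≡ true → on g (x + n) ≡ true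
  lap {g} {x} = trans (on-periodic g x)

  rim-lap : ∀ {i x} → on (rim i) x ≡ true → on (rim (i + n)) x ≡ true
  rim-lap {i} {x} = trans (rim-periodic i x)

  left-on : ∀ {x} → on (rim x) x ≡ true
  left-on {x} = ∈⇒on {rim x} (left∈h x)

  right-on : ∀ {x} → on (rim x) (suc x) ≡ true
  right-on {x} = ∈⇒on {rim x} (right∈h x)

  offset : ∀ {a k x} → a ≤ x → x < a + k → ∃[ j ] (x ≡ a + j × j < k)
  offset {a} {k} {x} l u with m≤n⇒∃[o]m+o≡n l
  ... | j , refl = j , refl , +-cancelˡ-< a j k u

  count-on : ∀ g a → #[ on g ] a n ≡ M
  count-on g a = trans (∑-periodic _ n (λ x → cong ι (on-periodic g x)) a 0) (size g)

  -- The `d + 1` positions from `x` to `x + d` would form a cycle closed by `f`.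
  F-avoids-d : ∀ {x} → F x ≡ true → F (x + d) ≡ true → ⊥
  F-avoids-d {x} Fx Fxd = no-cycle (parallel-cycle {x} {0} {suc x} {d′}
    (linear (x ∷ []) λ x → goal (x ⊕ # 0 <′ # 1 ⊕ x))
    (linear (x ∷ n ∷ d′ ∷ e′ ∷ []) (λ x n d e → 1 · # 1 ⊕ d ⊕ (# 1 ⊕ e) ≡′ n ⇒ goal (# 1 ⊕ x ⊕ d <′ x ⊕ n))
      (sym n≡d+e))
    (rim x) chord (inj₁ (≤-reflexive (+-identityʳ x) , ≤-refl)) tt (λ ())
    (at {rim x} (sym (+-identityʳ x)) left-on) right-on (at {chord} (+-suc x d′) Fxd) Fx)

  -- The positions `x + e` and `x + n` are at distance `d`.
  F-avoids-e : ∀ {x} → F x ≡ true → F (x + e) ≡ true → ⊥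
  F-avoids-e {x} Fx Fxe = F-avoids-d Fxe (at {chord}
    (linear (x ∷ n ∷ d′ ∷ e′ ∷ []) (λ x n d e →
      1 · n ≡′ # 1 ⊕ d ⊕ (# 1 ⊕ e) ⇒ goal (x ⊕ n ≡′ x ⊕ (# 1 ⊕ e) ⊕ (# 1 ⊕ d))) n≡d+e)
    (lap {chord} Fx))

  -- Exclusions between `f` and one rim edge

  module _ {w : ℕ} where

    -- The cycle is `w —h_w— x+1 ⋯ x+d —f— w`.
    after-exclusion : F w ≡ true → ∀ {x} → w ≤ x → x < w + e →
                      on (rim w) (suc x) ≡ true → F (x + d) ≡ true → ⊥
    after-exclusion Fw {x} l u Hx Fx = no-cycle (parallel-cycle {w} {0} {suc x} {d′}
      (s≤s (subst (_≤ x) (sym (+-identityʳ w)) l))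
      (linear (w ∷ x ∷ n ∷ d′ ∷ e′ ∷ []) (λ w x n d e →
        1 · x <′ w ⊕ (# 1 ⊕ e) ⇒ 1 · # 1 ⊕ d ⊕ (# 1 ⊕ e) ≡′ n ⇒ goal (# 1 ⊕ x ⊕ d <′ w ⊕ n)) u (sym n≡d+e))
      (rim w) chord (inj₁ (≤-reflexive (+-identityʳ w) , s≤s l)) tt (λ ())
      (at {rim w} (sym (+-identityʳ w)) left-on) Hx (at {chord} (+-suc x d′) Fx) Fw)

    -- The cycle is `x+e ⋯ w+n —f— x+n ⋯ w+1+n —h_w— x+e`, the second arc descending; it omits just
    -- the `e - 1` positions between `x` and `x + e`.
    before-exclusion : F w ≡ true → ∀ {x} → suc w ≤ x → x < suc w + d →
                       F x ≡ true → on (rim w) (suc (x + e′)) ≡ true → ⊥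
    before-exclusion Fw l u Fx Hx with offset l u
    ... | k , refl , k<d with m≤n⇒∃[o]m+o≡n k<d
    ... | a , k+a≡d = no-cycle (subst (λ y → BergeCycle H (suc (suc y))) (trans (+-comm a k) (suc-injective k+a≡d))
      (crossing-cycle {suc (suc w + k + e′)} {a} {suc w + n} {k}
        (≤-reflexive (cong suc p+a≡w+n))
        (linear (w ∷ k ∷ n ∷ e′ ∷ []) λ w k n e →
          goal (# 1 ⊕ w ⊕ n ⊕ k <′ # 1 ⊕ (# 1 ⊕ w ⊕ k ⊕ e) ⊕ n))
        chord (rim (w + n)) tt (inj₁ (≤-reflexive p+a≡w+n , ≤-refl)) (λ ())
        (at {chord} (sym p+a≡w+n) (lap {chord} Fw))
        (at {chord} (linear (w ∷ k ∷ n ∷ []) λ w k n → goal (# 1 ⊕ w ⊕ k ⊕ n ≡′ # 1 ⊕ w ⊕ n ⊕ k)) (lap {chord} Fx))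
        right-on (rim-lap {w} Hx)))
      where
      p+a≡w+n : suc (suc w + k + e′) + a ≡ w + n
      p+a≡w+n = linear (w ∷ k ∷ a ∷ n ∷ d′ ∷ e′ ∷ []) (λ w k a n d e →
        1 · # 1 ⊕ k ⊕ a ≡′ # 1 ⊕ d ⇒ 1 · # 1 ⊕ d ⊕ (# 1 ⊕ e) ≡′ n ⇒
        goal (# 1 ⊕ (# 1 ⊕ w ⊕ k ⊕ e) ⊕ a ≡′ w ⊕ n)) k+a≡d (sym n≡d+e)

    -- This and `before-exclusionᵐ` reflect the rim, so that the end of `h_w` known to lie in `f` is
    -- `w + 1`. The cycle is `w+1 ⋯ x —h_w— w+n ⋯ x+e —f— w+1`, the second arc descending.
    after-exclusionᵐ : F (suc w) ≡ true → ∀ {x} → suc w ≤ x → x < suc w + d →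
                       on (rim w) x ≡ true → F (x + e) ≡ true → ⊥
    after-exclusionᵐ FW l u Hx Fx with offset l u
    ... | j , refl , j<d with m≤n⇒∃[o]m+o≡n j<d
    ... | b , j+b≡d = no-cycle (subst (λ y → BergeCycle H (suc (suc y))) (suc-injective j+b≡d)
      (crossing-cycle {suc w} {j} {suc w + j + e} {b}
        (linear (w ∷ j ∷ e′ ∷ []) λ w j e → goal (# 1 ⊕ w ⊕ j <′ # 1 ⊕ w ⊕ j ⊕ (# 1 ⊕ e)))
        (s≤s (≤-reflexive s+b≡w+n))
        (rim (w + n)) chord (inj₂ (≤-reflexive s+b≡w+n , ≤-refl)) tt (λ ())
        (rim-lap {w} Hx) (at {rim (w + n)} (sym s+b≡w+n) left-on) Fx FW))
      where
      s+b≡w+n : suc w + j + e + b ≡ w + n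
      s+b≡w+n = linear (w ∷ j ∷ b ∷ n ∷ d′ ∷ e′ ∷ []) (λ w j b n d e →
        1 · # 1 ⊕ j ⊕ b ≡′ # 1 ⊕ d ⇒ 1 · # 1 ⊕ d ⊕ (# 1 ⊕ e) ≡′ n ⇒
        goal (# 1 ⊕ w ⊕ j ⊕ (# 1 ⊕ e) ⊕ b ≡′ w ⊕ n)) j+b≡d (sym n≡d+e)

    -- The cycle is `w+1 —f— x ⋯ x+d′ —h_w— w+1`.
    before-exclusionᵐ : F (suc w) ≡ true → ∀ {x} → suc (suc w) ≤ x → x < suc (suc w) + e →
                        F x ≡ true → on (rim w) (x + d′) ≡ true → ⊥
    before-exclusionᵐ FW {x} l u Fx Hx = no-cycle (parallel-cycle {suc w} {0} {x} {d′}
      (subst (_< x) (sym (+-identityʳ (suc w))) l) (s≤s s+b≤w+n)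
      chord (rim (w + n)) tt (inj₂ (s+b≤w+n , ≤-refl)) (λ ())
      (at {chord} (sym (+-identityʳ (suc w))) FW) Fx (rim-lap {w} Hx) (rim-lap {w} right-on))
      where
      s+b≤w+n : x + d′ ≤ w + n
      s+b≤w+n = linear (w ∷ x ∷ n ∷ d′ ∷ e′ ∷ []) (λ w x n d e →
        1 · x <′ # 2 ⊕ w ⊕ (# 1 ⊕ e) ⇒ 1 · # 1 ⊕ d ⊕ (# 1 ⊕ e) ≡′ n ⇒ goal (x ⊕ d ≤′ w ⊕ n)) u (sym n≡d+e)

    -- One unit of slack comes from the formula in `deficit`, two from `n = 2 + M + M`.
    deficit-total : ∀ D → D + (M + M) ≡ suc (d + e) → D ≡ 3
    deficit-total D q = linear (D ∷ M ∷ n ∷ d′ ∷ e′ ∷ []) (λ D M n d e →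
      1 · D ⊕ (M ⊕ M) ≡′ # 1 ⊕ (# 1 ⊕ d ⊕ (# 1 ⊕ e)) ⇒ 1 · # 1 ⊕ d ⊕ (# 1 ⊕ e) ≡′ n ⇒
      1 · n ≡′ # 2 ⊕ M ⊕ M ⇒ goal (D ≡′ # 3)) q (sym n≡d+e) n≡2M+2

    not-true : ∀ {b} → (b ≡ true → ⊥) → b ≡ false
    not-true {true} h = ⊥-elim (h refl)
    not-true {false} h = refl

    -- On the stretch before w, h_w omits at most three positions of f; on the
    -- stretch after w, at most three of the translate of f by 1.
    rim-deficit : F w ≡ true →
      #[ (λ x → nor (on (rim w) (suc x)) (F (x + d))) ] w e +
      #[ (λ x → nor (F x) (on (rim w) (suc (x + e′)))) ] (suc w) d ≡ 3
    rim-deficit Fw = deficit-total _ (deficit F (λ x → on (rim w) (suc x)) w d e′ M Fw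
      (not-true (F-avoids-d Fw))
      (subst (λ k → #[ F ] w k ≡ M) n≡d+e (count-on chord w))
      (subst (λ k → #[ (λ x → on (rim w) (suc x)) ] w k ≡ M) n≡d+e
        (trans (∑-cong w n λ {x} _ _ → cong (λ y → ι (on (rim w) y)) (+-comm 1 x))
          (trans (∑-shift (λ x → ι (on (rim w) x)) 1 w n) (count-on (rim w) (w + 1)))))
      (after-exclusion Fw) (before-exclusion Fw))

    -- The count for the reflected rim: `w + 1` takes the place of `w`, and `d` and `e` change
    -- roles.
    rim-deficitᵐ : F (suc w) ≡ true →
      #[ (λ x → nor (on (rim w) x) (F (x + e))) ] (suc w) d +
      #[ (λ x → nor (F x) (on (rim w) (x + d′))) ] (suc (suc w)) e ≡ 3
    rim-deficitᵐ FW = deficit-total _ (trans (deficit F (on (rim w)) (suc w) e d′ M FW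
      (not-true (F-avoids-e FW))
      (subst (λ k → #[ F ] (suc w) k ≡ M) n≡e+d (count-on chord (suc w)))
      (subst (λ k → #[ on (rim w) ] (suc w) k ≡ M) n≡e+d (count-on (rim w) (suc w)))
      (after-exclusionᵐ FW) (before-exclusionᵐ FW)) (cong suc (+-comm e d)))
      where
      n≡e+d : n ≡ e + d
      n≡e+d = trans n≡d+e (+-comm d e)

  -- `f` and its translate by `e` are disjoint sets of size `M` in a period of `2 + M + M`
  -- positions.
  exceptions : ∀ a → #[ (λ x → nor (F x) (F (x + e))) ] a n ≡ 2
  exceptions a = linear (#[ (λ x → nor (F x) (F (x + e))) ] a n ∷ #[ F ] a n ∷ #[ (λ x → F (x + e)) ] a n ∷ M ∷ n ∷ [])
    (λ D s t M n → 1 · D ⊕ s ⊕ t ≡′ n ⇒ 1 · n ≡′ # 2 ⊕ M ⊕ M ⇒ 1 · M ≡′ s ⇒ 1 · M ≡′ t ⇒ goal (D ≡′ # 2))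
    (count-nor F _ a n λ _ _ → F-avoids-e) n≡2M+2 (sym (count-on chord a))
    (sym (trans (∑-shift (λ x → ι (F x)) e a n) (count-on chord (a + e))))

  exceptionsᵐ : ∀ a → #[ (λ x → nor (F x) (F (x + d))) ] a n ≡ 2
  exceptionsᵐ a = linear (#[ (λ x → nor (F x) (F (x + d))) ] a n ∷ #[ F ] a n ∷ #[ (λ x → F (x + d)) ] a n ∷ M ∷ n ∷ [])
    (λ D s t M n → 1 · D ⊕ s ⊕ t ≡′ n ⇒ 1 · n ≡′ # 2 ⊕ M ⊕ M ⇒ 1 · M ≡′ s ⇒ 1 · M ≡′ t ⇒ goal (D ≡′ # 2))
    (count-nor F _ a n λ _ _ → F-avoids-d) n≡2M+2 (sym (count-on chord a))
    (sym (trans (∑-shift (λ x → ι (F x)) d a n) (count-on chord (a + d))))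

-- Long cycles

module LongCycle {n : ℕ} {H : Hypergraph n} (U : Unrolled H) (M : ℕ) (n≡2M+2 : n ≡ 2 + M + M)
  (size : ∀ g → #[ Cycles.on U g ] 0 n ≡ M)
  (d″ e″ : ℕ) (n≡d+e : n ≡ suc (suc d″) + suc (suc e″)) (no-cycle : ¬ BergeCycle H (3 + d″)) where
  open Unrolled U
  open Cycles U
  open NoCycle U M n≡2M+2 size (suc d″) (suc e″) n≡d+e no-cycle

  d′ e′ : ℕ
  d′ = suc d″
  e′ = suc e″

  n≥d+e : d + e ≤ n
  n≥d+e = ≤-reflexive (sym n≡d+e)

  -- The cycle is `w+2 ⋯ x —h_w— w+n ⋯ x+e′ —h_{w+1}— w+2`, the second arc descending. It omits
  -- `w + 1` and the `e - 2` positions between `x` and `x + e′`, hence has `d + 1` vertices.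
  skip-exclusion : ∀ {w x} → 2 + w ≤ x → x < 2 + w + d →
                   on (rim w) x ≡ true → on (rim (suc w)) (x + e′) ≡ true → ⊥
  skip-exclusion {w} l u Hw HW with offset l u
  ... | a , refl , a<d with m≤n⇒∃[o]m+o≡n a<d
  ... | b , a+b≡d = no-cycle (subst (λ y → BergeCycle H (suc (suc y))) (suc-injective a+b≡d)
    (crossing-cycle {2 + w} {a} {2 + w + a + e′} {b}
      (linear (w ∷ a ∷ e″ ∷ []) λ w a e → goal (# 2 ⊕ w ⊕ a <′ # 2 ⊕ w ⊕ a ⊕ (# 1 ⊕ e)))
      (≤-trans (s≤s (≤-reflexive s+b≡w+n)) (s≤s (n≤1+n (w + n))))
      (rim (w + n)) (rim (suc w + n))
      (inj₂ (≤-reflexive s+b≡w+n , s≤s (n≤1+n (w + n))))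
      (inj₂ (≤-trans (≤-reflexive s+b≡w+n) (n≤1+n (w + n)) , ≤-refl))
      (λ e → <⇒≢ ≤-refl (rim-injective e))
      (rim-lap {w} Hw) (at {rim (w + n)} (sym s+b≡w+n) left-on) (rim-lap {suc w} HW) (rim-lap {suc w} right-on)))
    where
    s+b≡w+n : 2 + w + a + e′ + b ≡ w + n
    s+b≡w+n = linear (w ∷ a ∷ b ∷ n ∷ d″ ∷ e″ ∷ []) (λ w a b n d e →
      1 · # 1 ⊕ a ⊕ b ≡′ # 2 ⊕ d ⇒ 1 · # 2 ⊕ d ⊕ (# 2 ⊕ e) ≡′ n ⇒
      goal (# 2 ⊕ w ⊕ a ⊕ (# 1 ⊕ e) ⊕ b ≡′ w ⊕ n)) a+b≡d (sym n≡d+e)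

  -- The number of runs of `f`

  start-after : ℕ → Bool
  start-after y = F (suc y) ∧ not (F y)

  starts : ℕ → ℕ → ℕ
  starts = #[ start-after ]

  start-after-periodic : ∀ y → ι (start-after (y + n)) ≡ ι (start-after y)
  start-after-periodic y = cong₂ (λ a b → ι (a ∧ not b)) (on-periodic chord (suc y)) (on-periodic chord y)

  -- Suppose `f` contains `y + 1` and `y + e`, which are at distance `e - 1`. Then it contains
  -- neither `y + 1 + e` nor `y`. As `h_w` cannot contain `y + 1` while `h_{w+1}` contains `y + e`,
  -- one of the two deficits counts an exception at this place.
  recurrence-bound : ∀ a b c d′ e′ f → (a ≡ true → e′ ≡ true → ⊥) → (d′ ≡ true → b ≡ true → ⊥) →
    (c ≡ true → f ≡ true → ⊥) → ι (a ∧ b) ≤ ι (nor c e′) + ι (nor d′ f)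
  recurrence-bound false b c d′ e′ f _ _ _ = z≤n
  recurrence-bound true false c d′ e′ f _ _ _ = z≤n
  recurrence-bound true true c d′ true f h _ _ = ⊥-elim (h refl refl)
  recurrence-bound true true c true false f _ h _ = ⊥-elim (h refl refl)
  recurrence-bound true true false false false f _ _ _ = s≤s z≤n
  recurrence-bound true true true false false true _ _ h = ⊥-elim (h refl refl)
  recurrence-bound true true true false false false _ _ _ = s≤s z≤n

  -- When a run starts at `y + 1`, either `y + e` lies in `f`, at distance `e - 1`, or `f` and its
  -- translate by `e` both miss `y`.
  start-bound : ∀ a b c → ι (a ∧ not b) ≤ ι (a ∧ c) + ι (nor b c)
  start-bound false b c = z≤n
  start-bound true true c = z≤n
  start-bound true false true = s≤s z≤n
  start-bound true false false = s≤s z≤n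

  -- h_w and h_{w+1} both contain f up to three exceptions, and bypassing w + 1
  -- through them shows that f almost avoids e′ as well as e.
  starts-after-suc : ∀ w → F (suc w) ≡ true → starts (2 + w) d″ ≤ 8
  starts-after-suc w FW =
    linear (starts (2 + w) d″ ∷ R ∷ A ∷ B ∷ P ∷ Q ∷ P′ ∷ Q′ ∷ N ∷ N′ ∷ [])
      (λ s r a b p q p′ q′ ν ν′ → 1 · s ≤′ r ⊕ ν ⇒ 1 · r ≤′ a ⊕ b ⇒ 1 · a ≤′ p ⇒ 1 · b ≤′ q ⇒
        1 · p ⊕ p′ ≡′ # 3 ⇒ 1 · q′ ⊕ q ≡′ # 3 ⇒ 1 · ν ≤′ ν′ ⇒ 1 · ν′ ≡′ # 2 ⇒ goal (s ≤′ # 8))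
      start≤ recur≤ A≤P B≤Q (rim-deficitᵐ FW) (rim-deficit FW) (∑-prefix _ (2 + w) d″≤n) (exceptions (2 + w))
    where
    R A B P Q P′ Q′ N N′ : ℕ
    R = #[ (λ y → F (suc y) ∧ F (y + e)) ] (2 + w) d″
    A = #[ (λ y → nor (on (rim w) (suc y)) (F (suc y + e))) ] (2 + w) d″
    B = #[ (λ y → nor (F y) (on (rim (suc w)) (suc (y + e′)))) ] (2 + w) d″
    P = #[ (λ x → nor (on (rim w) x) (F (x + e))) ] (suc w) d
    P′ = #[ (λ x → nor (F x) (on (rim w) (x + d′))) ] (2 + w) e
    Q = #[ (λ x → nor (F x) (on (rim (suc w)) (suc (x + e′)))) ] (2 + w) d
    Q′ = #[ (λ x → nor (on (rim (suc w)) (suc x)) (F (x + d))) ] (suc w) e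
    N = #[ (λ y → nor (F y) (F (y + e))) ] (2 + w) d″
    N′ = #[ (λ y → nor (F y) (F (y + e))) ] (2 + w) n
    d″≤n : d″ ≤ n
    d″≤n = linear (d″ ∷ e″ ∷ n ∷ []) (λ d e n → 1 · # 2 ⊕ d ⊕ (# 2 ⊕ e) ≤′ n ⇒ goal (d ≤′ n)) n≥d+e
    start≤ : starts (2 + w) d″ ≤ R + N
    start≤ = ≤-trans (∑-mono (2 + w) d″ λ {y} _ _ → start-bound (F (suc y)) (F y) (F (y + e)))
      (≤-reflexive (∑-+ _ _ (2 + w) d″))
    recur≤ : R ≤ A + B
    recur≤ = ≤-trans (∑-mono (2 + w) d″ λ {y} l u →
        recurrence-bound (F (suc y)) (F (y + e)) (on (rim w) (suc y)) (F y) (F (suc y + e)) _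
          F-avoids-e F-avoids-e
          (skip-exclusion (m≤n⇒m≤1+n l)
            (linear (w ∷ d″ ∷ y ∷ []) (λ w d y → 1 · y <′ # 2 ⊕ w ⊕ d ⇒ goal (# 1 ⊕ y <′ # 2 ⊕ w ⊕ (# 2 ⊕ d))) u)))
      (≤-reflexive (∑-+ _ _ (2 + w) d″))
    A≤P : A ≤ P
    A≤P = ≤-trans (≤-reflexive (∑-suc (λ x → ι (nor (on (rim w) x) (F (x + e)))) (2 + w) d″))
      (≤-trans (m≤n+m _ (p (2 + w))) (m≤n+m _ (p (suc w))))
      where
      p : ℕ → ℕ
      p x = ι (nor (on (rim w) x) (F (x + e)))
    B≤Q : B ≤ Q
    B≤Q = ∑-prefix _ (2 + w) (≤-trans (n≤1+n d″) (n≤1+n (suc d″)))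

  starts-after : ∀ a → F a ≡ true → starts (suc a) d″ ≤ 8
  starts-after a Fa = subst (_≤ 8) shifted (starts-after-suc w
      (at {chord} a+n≡ (lap {chord} Fa)))
    where
    w : ℕ
    -- This is `a + n - 1`; the added period covers the case that `a` is 0.
    w = a + (suc d″ + suc (suc e″))
    a+n≡ : a + n ≡ suc w
    a+n≡ = trans (cong (a +_) n≡d+e) (+-suc a _)
    shifted : starts (2 + w) d″ ≡ starts (suc a) d″
    shifted = trans (cong (λ z → starts (suc z) d″) (sym a+n≡))
      (trans (sym (∑-shift _ n (suc a) d″)) (∑-cong (suc a) d″ λ {y} _ _ → start-after-periodic y))

  -- No run starts right after `a`, since `a` is already in `f`.
  starts-from : ∀ a L → F a ≡ true → L ≤ d′ → starts a L ≤ 8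
  starts-from a zero Fa _ = z≤n
  starts-from a (suc L) Fa (s≤s L≤) rewrite Fa with F (suc a)
  ... | true = ≤-trans (∑-prefix _ (suc a) L≤) (starts-after a Fa)
  ... | false = ≤-trans (∑-prefix _ (suc a) L≤) (starts-after a Fa)

  -- Scanning forward to the first position of `f` meets at most one start, and `starts-from` bounds
  -- the rest.
  starts-window : ∀ a L → L ≤ d′ → starts a L ≤ 9
  starts-window a zero _ = z≤n
  starts-window a (suc L) L< with F a in Fa
  ... | true = m≤n⇒m≤1+n (subst (_≤ 8) (cong (λ b → ι (F (suc a) ∧ not b) + starts (suc a) L) Fa)
                 (starts-from a (suc L) Fa L<))
  ... | false with F (suc a) in Fa′
  ...   | true = s≤s (starts-from (suc a) L Fa′ (<⇒≤ L<))
  ...   | false = starts-window (suc a) L (<⇒≤ L<)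

  all-on none-on : ℕ → ℕ → Bool
  all-on zero x = true
  all-on (suc r) x = F x ∧ all-on r (suc x)
  none-on zero x = true
  none-on (suc r) x = not (F x) ∧ none-on r (suc x)

  ∧-true : ∀ {a b} → a ∧ b ≡ true → a ≡ true × b ≡ true
  ∧-true {true} {true} refl = refl , refl

  all-on⇒F : ∀ r {x y} → all-on r x ≡ true → x ≤ y → y < x + r → F y ≡ true
  all-on⇒F zero {x} {y} h l u = ⊥-elim (<⇒≱ u (subst (_≤ y) (sym (+-identityʳ x)) l))
  all-on⇒F (suc r) {x} {y} h l u with ∧-true {F x} h | m≤n⇒m<n∨m≡n l
  ... | Fx , _ | inj₂ refl = Fx
  ... | _ , h′ | inj₁ x<y = all-on⇒F r h′ x<y (subst (y <_) (+-suc x r) u)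

  none-on⇒¬F : ∀ r {x y} → none-on r x ≡ true → x ≤ y → y < x + r → F y ≡ true → ⊥
  none-on⇒¬F zero {x} {y} h l u _ = <⇒≱ u (subst (_≤ y) (sym (+-identityʳ x)) l)
  none-on⇒¬F (suc r) {x} {y} h l u Fy with ∧-true {not (F x)} h | m≤n⇒m<n∨m≡n l
  ... | ¬Fx , _ | inj₂ refl with F x
  ...   | true = case-false ¬Fx
    where
    case-false : false ≡ true → ⊥
    case-false ()
  none-on⇒¬F (suc r) {x} {y} h l u () | _ , _ | inj₂ refl | false
  none-on⇒¬F (suc r) {x} {y} h l u Fy | _ , h′ | inj₁ x<y =
    none-on⇒¬F r h′ x<y (subst (y <_) (+-suc x r) u) Fy

  -- Going back from a position of `f`, one either stays in `f` or passes the start of its run.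
  -- `off-bound` is the analogue going forward from a position outside `f`.
  on-bound : ∀ r x → ι (F (x + r)) ≤ ι (all-on (suc r) x) + starts x r
  on-bound zero x rewrite +-identityʳ x with F x
  ... | true = s≤s z≤n
  ... | false = z≤n
  on-bound (suc r) x = ≤-trans (≤-reflexive (cong (λ y → ι (F y)) (+-suc x r)))
    (≤-trans (on-bound r (suc x)) (combine (F x) (F (suc x)) (all-on r (2 + x)) (starts (suc x) r)))
    where
    combine : ∀ a b c k → ι (b ∧ c) + k ≤ ι (a ∧ b ∧ c) + (ι (b ∧ not a) + k)
    combine true b c k = +-monoʳ-≤ (ι (b ∧ c)) (m≤n+m k _)
    combine false true true k = ≤-refl
    combine false true false k = m≤n+m k 1
    combine false false c k = ≤-refl

  off-bound : ∀ r x → ι (not (F x)) ≤ ι (none-on (suc r) x) + starts x r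
  off-bound zero x with F x
  ... | true = z≤n
  ... | false = s≤s z≤n
  off-bound (suc r) x = combine (F x) (F (suc x)) (none-on r (2 + x)) (starts (suc x) r) (off-bound r (suc x))
    where
    combine : ∀ a b c k → ι (not b) ≤ ι (not b ∧ c) + k → ι (not a) ≤ ι (not a ∧ not b ∧ c) + (ι (b ∧ not a) + k)
    combine true b c k h = z≤n
    combine false true c k h = s≤s z≤n
    combine false false c k h = h

  -- After exchanging the sums, each of the `r` offsets contributes one window.
  ∑-∑ : ∀ p B a L r → (∀ b → ∑ p b L ≤ B) → ∑ (λ x → ∑ p x r) a L ≤ r * B
  ∑-∑ p B a L zero h = ≤-reflexive (trans (∑-const 0 a L) (*-zeroʳ L))
  ∑-∑ p B a L (suc r) h = ≤-trans (≤-reflexive (trans (∑-+ p (λ x → ∑ p (suc x) r) a L)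
      (cong (∑ p a L +_) (∑-suc (λ x → ∑ p x r) a L))))
    (+-mono-≤ (h a) (∑-∑ p B (suc a) L r h))

  -- With `x₀ = t + α` and `w = x₀ + 6` the cycle is `t+i ⋯ x₀+i —h_w— w+1 ⋯ t+6+d —f— t+i` for some
  -- `i < 6`. With at most two exceptions `t + i` is in `f`, because `t + i + d` lies in the gap.
  -- With at most three, `h_w` contains `x₀ + i`: the run contains `x₀ + i + 1`, so `f` misses
  -- `x₀ + i + 1 + e`, and the reflected deficit applies. So at least one of six candidates
  -- survives.
  chord-avoids-end : ∀ t → F (t + 6 + d) ≡ true → none-on 6 (t + d) ≡ true →
                     ∀ {α} → α < d → all-on 8 (t + α) ≡ true → ⊥
  chord-avoids-end t Fc gap {α} α<d run with m≤n⇒∃[o]m+o≡n α<d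
  ... | b , α+b≡d = found (non-member bad 0 6 bad<6)
    where
    x₀ w ε : ℕ
    x₀ = t + α
    w = x₀ + 6
    Fx₀+ : ∀ j → j < 8 → F (x₀ + j) ≡ true
    Fx₀+ j j<8 = all-on⇒F 8 run (m≤m+n x₀ j) (+-monoʳ-< x₀ j<8)
    7<e : 7 < e
    -- A run of eight contains two positions at every distance up to 7.
    7<e with e ≤? 7
    ... | yes e≤7 = ⊥-elim (F-avoids-e (at {chord} (+-identityʳ x₀) (Fx₀+ 0 (s≤s z≤n))) (Fx₀+ e (s≤s e≤7)))
    ... | no e≰7 = ≰⇒> e≰7
    ε = proj₁ (m≤n⇒∃[o]m+o≡n 7<e)
    8+ε≡e : 8 + ε ≡ e
    8+ε≡e = proj₂ (m≤n⇒∃[o]m+o≡n 7<e)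
    bad : ℕ → Bool
    bad i = nor (F (i + t)) (F (i + t + d)) ∨ not (on (rim w) (i + x₀))
    gap₁ gap₂ : ℕ → Bool
    gap₁ x = nor (F x) (F (x + d))
    gap₂ x = nor (F x) (on (rim w) (x + d′))
    z₀ : ℕ
    -- As `8 + ε` is `e`, this is `x₀ + 1 + e`; adding `d′` gives `x₀ + n`.
    z₀ = 9 + ε + x₀
    pointwise : ∀ {i} → i < 6 → ι (bad i) ≤ ι (gap₁ (i + t)) + ι (gap₂ (i + z₀))
    pointwise {i} i<6 = combine (gap₁ (i + t)) (F (i + z₀)) (on (rim w) (i + x₀)) (on (rim w) (i + z₀ + d′))
      ¬Fz (trans (cong (on (rim w)) z≡) (on-periodic (rim w) (i + x₀)))
      where
      combine : ∀ g a b c → (a ≡ true → ⊥) → c ≡ b → ι (g ∨ not b) ≤ ι g + ι (nor a c)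
      combine g true b c h _ = ⊥-elim (h refl)
      combine true false b .b h refl = s≤s z≤n
      combine false false b .b h refl = ≤-refl
      z≡ : i + z₀ + d′ ≡ i + x₀ + n
      z≡ = linear (i ∷ x₀ ∷ ε ∷ d″ ∷ e″ ∷ n ∷ []) (λ i x ε d e n →
        1 · # 8 ⊕ ε ≡′ # 2 ⊕ e ⇒ 1 · # 2 ⊕ d ⊕ (# 2 ⊕ e) ≡′ n ⇒
        goal (i ⊕ (# 9 ⊕ ε ⊕ x) ⊕ (# 1 ⊕ d) ≡′ i ⊕ x ⊕ n)) 8+ε≡e (sym n≡d+e)
      ¬Fz : F (i + z₀) ≡ true → ⊥
      ¬Fz Fz = F-avoids-e (Fx₀+ (1 + i) (≤-trans (s≤s i<6) (n≤1+n 7)))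
        (at {chord} (linear (i ∷ x₀ ∷ ε ∷ e″ ∷ []) (λ i x ε e → 1 · # 8 ⊕ ε ≡′ # 2 ⊕ e ⇒
          goal (i ⊕ (# 9 ⊕ ε ⊕ x) ≡′ x ⊕ (# 1 ⊕ i) ⊕ (# 2 ⊕ e))) 8+ε≡e) Fz)
    6≤n : 6 ≤ n
    6≤n = linear (ε ∷ d″ ∷ e″ ∷ n ∷ []) (λ ε d e n → 1 · # 8 ⊕ ε ≤′ # 2 ⊕ e ⇒ 1 · # 2 ⊕ d ⊕ (# 2 ⊕ e) ≤′ n ⇒
      goal (# 6 ≤′ n)) (≤-reflexive 8+ε≡e) n≥d+e
    sub : #[ gap₂ ] z₀ 6 ≤ #[ gap₂ ] (2 + w) e
    sub = ≤-trans (m≤n+m _ (#[ gap₂ ] (2 + w) (suc ε))) (≤-trans (≤-reflexive (sym (trans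
        (∑-split (λ x → ι (gap₂ x)) (2 + w) (suc ε) 6) (cong (λ y → #[ gap₂ ] (2 + w) (suc ε) + #[ gap₂ ] y 6)
        (linear (x₀ ∷ ε ∷ []) λ x ε → goal (# 2 ⊕ (x ⊕ # 6) ⊕ (# 1 ⊕ ε) ≡′ # 9 ⊕ ε ⊕ x))))))
      (∑-prefix (λ x → ι (gap₂ x)) (2 + w) (linear (ε ∷ e″ ∷ []) (λ ε e → 1 · # 8 ⊕ ε ≤′ # 2 ⊕ e ⇒
        goal (# 1 ⊕ ε ⊕ # 6 ≤′ # 2 ⊕ e)) (≤-reflexive 8+ε≡e))))
    bad<6 : #[ bad ] 0 6 < 6
    bad<6 = linear (#[ bad ] 0 6 ∷ #[ gap₁ ] t 6 ∷ #[ gap₂ ] z₀ 6 ∷ #[ gap₁ ] t n ∷ #[ gap₂ ] (2 + w) e ∷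
                    #[ (λ x → nor (on (rim w) x) (F (x + e))) ] (suc w) d ∷ [])
      (λ s g₁ g₂ g₁′ g₂′ k → 1 · s ≤′ g₁ ⊕ g₂ ⇒ 1 · g₁ ≤′ g₁′ ⇒ 1 · g₁′ ≡′ # 2 ⇒ 1 · g₂ ≤′ g₂′ ⇒
        1 · k ⊕ g₂′ ≡′ # 3 ⇒ goal (s <′ # 6))
      (≤-trans (∑-mono 0 6 λ _ u → pointwise u) (≤-reflexive (trans (∑-+ (λ i → ι (gap₁ (i + t))) (λ i → ι (gap₂ (i + z₀))) 0 6)
        (cong₂ _+_ (∑-shift (λ x → ι (gap₁ x)) t 0 6) (∑-shift (λ x → ι (gap₂ x)) z₀ 0 6)))))
      (∑-prefix _ t 6≤n) (exceptionsᵐ t) sub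
      (rim-deficitᵐ {w} (at {chord} (+-suc x₀ 6) (Fx₀+ 7 ≤-refl)))
    found : ∃[ i ] (0 ≤ i × i < 6 × bad i ≡ false) → ⊥
    found (i , _ , i<6 , good) = no-cycle (subst (λ y → BergeCycle H (suc (suc y))) (suc-injective α+b≡d)
      (parallel-cycle {i + t} {α} {suc w} {b}
        (s≤s i+x₀≤w)
        (linear (i ∷ t ∷ α ∷ b ∷ ε ∷ d″ ∷ e″ ∷ n ∷ []) (λ i t α b ε d e n → 1 · # 1 ⊕ α ⊕ b ≤′ # 2 ⊕ d ⇒
          1 · # 8 ⊕ ε ≤′ # 2 ⊕ e ⇒ 1 · # 2 ⊕ d ⊕ (# 2 ⊕ e) ≤′ n ⇒
          goal (# 1 ⊕ (t ⊕ α ⊕ # 6) ⊕ b <′ i ⊕ t ⊕ n)) (≤-reflexive α+b≡d) (≤-reflexive 8+ε≡e) n≥d+e)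
        (rim w) chord (inj₁ (i+x₀≤w , ≤-refl)) tt (λ ())
        (at {rim w} (sym (+-assoc i t α)) (proj₂ outcome)) right-on
        (at {chord} (linear (t ∷ α ∷ b ∷ d″ ∷ []) (λ t α b d → 1 · # 2 ⊕ d ≡′ # 1 ⊕ α ⊕ b ⇒
          goal (t ⊕ # 6 ⊕ (# 2 ⊕ d) ≡′ # 1 ⊕ (t ⊕ α ⊕ # 6) ⊕ b)) (sym α+b≡d)) Fc)
        (proj₁ outcome)))
      where
      i+x₀≤w : i + t + α ≤ w
      i+x₀≤w = linear (i ∷ t ∷ α ∷ []) (λ i t α → 1 · i <′ # 6 ⇒ goal (i ⊕ t ⊕ α ≤′ t ⊕ α ⊕ # 6)) i<6
      split : ∀ a b c → (b ≡ true → ⊥) → nor a b ∨ not c ≡ false → a ≡ true × c ≡ true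
      split a true c h _ = ⊥-elim (h refl)
      split true false true _ _ = refl , refl
      outcome : F (i + t) ≡ true × on (rim w) (i + x₀) ≡ true
      outcome = split (F (i + t)) (F (i + t + d)) (on (rim w) (i + x₀))
        (none-on⇒¬F 6 gap (linear (i ∷ t ∷ d ∷ []) λ i t d → goal (t ⊕ d ≤′ i ⊕ t ⊕ d))
          (linear (i ∷ t ∷ d ∷ []) (λ i t d → 1 · i <′ # 6 ⇒ goal (i ⊕ t ⊕ d <′ t ⊕ d ⊕ # 6)) i<6)) good

-- Concentration of `f` on an interval, and the contradiction

module LongContradiction {n : ℕ} {H : Hypergraph n} (U : Unrolled H) (M : ℕ) (n≡2M+2 : n ≡ 2 + M + M)
  (size : ∀ g → #[ Cycles.on U g ] 0 n ≡ M)
  (d″ e″ : ℕ) (n≡d+e : n ≡ suc (suc d″) + suc (suc e″)) (no-cycle : ¬ BergeCycle H (3 + d″))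
  (n≤7d′ : n ≤ 7 * suc d″) (large : 5000 ≤ M) where
  open Unrolled U
  open Cycles U
  open NoCycle U M n≡2M+2 size (suc d″) (suc e″) n≡d+e no-cycle
  open LongCycle U M n≡2M+2 size d″ e″ n≡d+e no-cycle

  -- With `x = x₀ + 7` the cycle is `x₀+j ⋯ x —h_x— y+1 ⋯ c+n —f— x₀+j`. For the four candidates
  -- `y = c + e + 1 + i` the position `y + d` falls into the gap after `c`, so by the deficit at `x`
  -- the edge `h_x` misses at most three of the `y + 1`. The choice `j = 6 - i` keeps the length at
  -- `d + 1`.
  chord-avoids-start : ∀ c → F c ≡ true → none-on 6 (suc c) ≡ true →
                       ∀ {x₀} → c < x₀ → x₀ + 7 ≤ c + e → all-on 8 x₀ ≡ true → ⊥
  chord-avoids-start c Fc gap {x₀} c<x₀ x≤c+e run = found (non-member missed y₀ 4 missed<4)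
    where
    x y₀ u : ℕ
    x = x₀ + 7
    y₀ = c + e + 1
    missed : ℕ → Bool
    missed y = not (on (rim x) (suc y))
    gap₁ : ℕ → Bool
    gap₁ y = nor (on (rim x) (suc y)) (F (y + d))
    u = proj₁ (m≤n⇒∃[o]m+o≡n x≤c+e)
    x+u≡ : x + u ≡ c + e
    x+u≡ = proj₂ (m≤n⇒∃[o]m+o≡n x≤c+e)
    pointwise : ∀ {y} → y₀ ≤ y → y < y₀ + 4 → ι (missed y) ≤ ι (gap₁ y)
    pointwise {y} l r with offset l r
    ... | i , refl , i<4 = combine (on (rim x) (suc y)) (F (y + d)) λ Fy →
      none-on⇒¬F 6 gap (m≤m+n (suc c) i) (+-monoʳ-< (suc c) (≤-trans i<4 (m≤m+n 4 2)))
        (trans (sym (on-periodic chord (suc c + i))) (at {chord}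
          (linear (c ∷ i ∷ d″ ∷ e″ ∷ n ∷ []) (λ c i d e n → 1 · # 2 ⊕ d ⊕ (# 2 ⊕ e) ≡′ n ⇒
            goal (c ⊕ (# 2 ⊕ e) ⊕ # 1 ⊕ i ⊕ (# 2 ⊕ d) ≡′ # 1 ⊕ c ⊕ i ⊕ n)) (sym n≡d+e)) Fy))
      where
      combine : ∀ a b → (b ≡ true → ⊥) → ι (not a) ≤ ι (nor a b)
      combine a true h = ⊥-elim (h refl)
      combine true false h = z≤n
      combine false false h = ≤-refl
    Fx : F x ≡ true
    Fx = all-on⇒F 8 run (m≤m+n x₀ 7) (+-monoʳ-< x₀ ≤-refl)
    missed<4 : #[ missed ] y₀ 4 < 4
    missed<4 = linear (#[ missed ] y₀ 4 ∷ #[ gap₁ ] y₀ 4 ∷ #[ gap₁ ] x e ∷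
                       #[ (λ x′ → nor (F x′) (on (rim x) (suc (x′ + e′)))) ] (suc x) d ∷ [])
      (λ s g g′ k → 1 · s ≤′ g ⇒ 1 · g ≤′ g′ ⇒ 1 · g′ ⊕ k ≡′ # 3 ⇒ goal (s <′ # 4))
      (∑-mono y₀ 4 pointwise)
      (≤-trans (m≤n+m _ (#[ gap₁ ] x (suc u))) (≤-trans (≤-reflexive (sym (trans
        (∑-split (λ y → ι (gap₁ y)) x (suc u) 4) (cong (λ y → #[ gap₁ ] x (suc u) + #[ gap₁ ] y 4)
          (linear (x ∷ u ∷ c ∷ e ∷ []) (λ x u c e → 1 · x ⊕ u ≡′ c ⊕ e ⇒
            goal (x ⊕ (# 1 ⊕ u) ≡′ c ⊕ e ⊕ # 1)) x+u≡)))))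
        (∑-prefix (λ y → ι (gap₁ y)) x (linear (x₀ ∷ u ∷ c ∷ e ∷ []) (λ x u c e →
          1 · x ⊕ # 7 ⊕ u ≤′ c ⊕ e ⇒ 1 · c <′ x ⇒ goal (# 1 ⊕ u ⊕ # 4 ≤′ e)) (≤-reflexive x+u≡) c<x₀))))
      (rim-deficit Fx)
    found : ∃[ y ] (y₀ ≤ y × y < y₀ + 4 × missed y ≡ false) → ⊥
    found (y , l , r , hit) with offset l r
    ... | i , refl , i<4 with m≤n⇒∃[o]m+o≡n (≤-trans i<4 (m≤n+m 4 3)) | m≤n⇒∃[o]m+o≡n k≤d′
      where
      k≤d′ : suc i ≤ d′
      k≤d′ = ≮⇒≥ λ d<k → linear (i ∷ n ∷ d′ ∷ M ∷ []) (λ i n d M → 1 · # 2 ⊕ M ⊕ M ≤′ n ⇒ 1 · n ≤′ 7 ⊗ d ⇒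
        2 · # 5000 ≤′ M ⇒ 7 · d <′ # 1 ⊕ i ⇒ 7 · i <′ # 4 ⇒ goal false′)
        (≤-reflexive (sym n≡2M+2)) n≤7d′ large d<k i<4
    ... | j , k+j≡7 | b , k+b≡d′ = no-cycle (subst (λ z → BergeCycle H (suc (suc z))) k+b≡d′
      (parallel-cycle {x₀ + j} {suc i} {suc y} {b}
        (linear (x₀ ∷ j ∷ i ∷ c ∷ e ∷ []) (λ x j i c e → 1 · # 1 ⊕ i ⊕ j ≤′ # 7 ⇒ 1 · x ⊕ # 7 ≤′ c ⊕ e ⇒
          goal (x ⊕ j ⊕ (# 1 ⊕ i) <′ # 1 ⊕ (c ⊕ e ⊕ # 1 ⊕ i))) (≤-reflexive k+j≡7) x≤c+e)
        (subst (_< x₀ + j + n) (sym s+b≡c+n) (+-monoˡ-< n (≤-trans c<x₀ (m≤m+n x₀ j))))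
        (rim x) chord
        (inj₁ (≤-reflexive p+a≡x , s≤s (linear (x ∷ i ∷ c ∷ e ∷ []) (λ x i c e → 1 · x ≤′ c ⊕ e ⇒
          goal (x ≤′ c ⊕ e ⊕ # 1 ⊕ i)) x≤c+e))) tt (λ ())
        (at {rim x} (sym p+a≡x) left-on) (not-false hit)
        (at {chord} (sym s+b≡c+n) (lap {chord} Fc))
        (all-on⇒F 8 run (m≤m+n x₀ j) (+-monoʳ-< x₀ (s≤s (≤-trans (m≤n+m j (suc i)) (≤-reflexive k+j≡7)))))))
      where
      not-false : ∀ {b} → not b ≡ false → b ≡ true
      not-false {true} _ = refl
      p+a≡x : x₀ + j + suc i ≡ x
      p+a≡x = linear (x₀ ∷ j ∷ i ∷ []) (λ x j i → 1 · # 1 ⊕ i ⊕ j ≡′ # 7 ⇒ goal (x ⊕ j ⊕ (# 1 ⊕ i) ≡′ x ⊕ # 7)) k+j≡7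
      s+b≡c+n : suc y + b ≡ c + n
      s+b≡c+n = linear (c ∷ i ∷ b ∷ d″ ∷ e″ ∷ n ∷ []) (λ c i b d e n → 1 · # 1 ⊕ i ⊕ b ≡′ # 1 ⊕ d ⇒
        1 · # 2 ⊕ d ⊕ (# 2 ⊕ e) ≡′ n ⇒ goal (# 1 ⊕ (c ⊕ (# 2 ⊕ e) ⊕ # 1 ⊕ i) ⊕ b ≡′ c ⊕ n)) k+b≡d′ (sym n≡d+e)

  starts-blocks : ∀ q a → starts a (q * d′) ≤ q * 9
  starts-blocks zero a = z≤n
  starts-blocks (suc q) a = ≤-trans (≤-reflexive (∑-split _ a d′ (q * d′)))
    (+-mono-≤ (starts-window a d′ ≤-refl) (starts-blocks q (a + d′)))

  -- A period is covered by seven windows of length `d′` with at most nine starts each.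
  starts-total : ∀ a {L} → L ≤ n → starts a L ≤ 63
  starts-total a L≤n = ≤-trans (∑-prefix _ a (≤-trans L≤n n≤7d′)) (starts-blocks 7 a)

  -- By `on-bound` every position of `f` here has a start at one of the seven offsets before it, and
  -- each offset accounts for at most 63 positions.
  few-without-runs : ∀ a L → L ≤ n → (∀ {x} → a ≤ x → x < a + L → all-on 8 x ≡ true → ⊥) →
                     #[ F ] (a + 7) L ≤ 441
  few-without-runs a L L≤n none = begin
    #[ F ] (a + 7) L                                         ≡⟨ ∑-shift (λ x → ι (F x)) 7 a L ⟨
    ∑ (λ x → ι (F (x + 7))) a L                              ≤⟨ ∑-mono a L (λ {x} _ _ → on-bound 7 x) ⟩
    ∑ (λ x → ι (all-on 8 x) + starts x 7) a L                ≡⟨ ∑-+ (λ x → ι (all-on 8 x)) (λ x → starts x 7) a L ⟩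
    #[ all-on 8 ] a L + ∑ (λ x → starts x 7) a L             ≤⟨ +-mono-≤ (≤-reflexive (none⇒count≡0 (all-on 8) a L none))
                                                                  (∑-∑ (λ x → ι (start-after x)) 63 a L 7 (λ b → starts-total b L≤n)) ⟩
    441                                                      ∎
    where open ≤-Reasoning

  -- `f` misses `M + 2` positions of a period, of which at most `5 * 63 = 315` fail to begin a gap.
  long-gap : ∀ a → ∃[ g ] (a ≤ g × g < a + n × none-on 6 g ≡ true)
  long-gap a = member (none-on 6) a n
    (linear (#[ (λ x → not (F x)) ] a n ∷ #[ none-on 6 ] a n ∷ ∑ (λ x → starts x 5) a n ∷ M ∷ n ∷ [])
      (λ v g s M n → 1 · v ≤′ g ⊕ s ⇒ 1 · s ≤′ # 315 ⇒ 1 · n ≡′ M ⊕ v ⇒ 1 · # 2 ⊕ M ⊕ M ≡′ n ⇒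
        1 · # 5000 ≤′ M ⇒ goal (# 1 ≤′ g))
      (≤-trans (∑-mono a n λ {x} _ _ → off-bound 5 x) (≤-reflexive (∑-+ (λ x → ι (none-on 6 x)) _ a n)))
      (∑-∑ (λ x → ι (start-after x)) 63 a n 5 (λ b → starts-total b ≤-refl))
      (sym (trans (cong (_+ #[ (λ x → not (F x)) ] a n) (sym (count-on chord a))) (count-not F a n)))
      (sym n≡2M+2) large)

  chord-nonempty : ∀ a → 1 ≤ #[ F ] a n
  chord-nonempty a = subst (1 ≤_) (sym (count-on chord a)) (≤-trans (s≤s z≤n) large)

  none-extend : ∀ r x → none-on r x ≡ true → F (x + r) ≡ false → none-on (suc r) x ≡ true
  none-extend zero x _ h rewrite +-identityʳ x | h = refl
  none-extend (suc r) x h h′ with ∧-true {not (F x)} h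
  ... | ¬Fx , rest rewrite ¬Fx = none-extend r (suc x) rest (trans (cong F (sym (+-suc x r))) h′)

  none-shrink : ∀ r x → none-on (suc r) x ≡ true → none-on r x ≡ true
  none-shrink zero x _ = refl
  none-shrink (suc r) x h with ∧-true {not (F x)} h
  ... | ¬Fx , rest rewrite ¬Fx = none-shrink r (suc x) rest

  -- The gap slides forward until the position right after it lies in `f`.
  first-after-gap : ∀ k g → none-on 6 g ≡ true → F (g + 6 + k) ≡ true →
                    ∃[ t ] (g ≤ t × F (t + 6) ≡ true × none-on 6 t ≡ true)
  first-after-gap zero g gap Fk = g , ≤-refl , at {chord} (+-identityʳ (g + 6)) Fk , gap
  first-after-gap (suc k) g gap Fk with F (g + 6) in Fg
  ... | true = g , ≤-refl , Fg , gap
  ... | false with first-after-gap k (suc g) (proj₂ (∧-true {not (F g)} (none-extend 6 g gap Fg)))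
                    (at {chord} (+-suc (g + 6) k) Fk)
  ... | t , g<t , rest = t , <⇒≤ g<t , rest

  last-before-gap : ∀ k p → F p ≡ true → none-on 6 (suc (p + k)) ≡ true →
                    ∃[ c ] (F c ≡ true × none-on 6 (suc c) ≡ true)
  last-before-gap zero p Fp gap = p , Fp , subst (λ y → none-on 6 (suc y) ≡ true) (+-identityʳ p) gap
  last-before-gap (suc k) p Fp gap with F (p + suc k) in Fy
  ... | true = p + suc k , Fy , gap
  ... | false = last-before-gap k p Fp (subst (λ y → none-on 6 y ≡ true) (+-suc p k)
                  (none-shrink 6 (p + suc k) (cong₂ _∧_ (cong not Fy) gap)))

  -- By `chord-avoids-end` the `d` positions ending at `t + 6` contain at most 441 of `f`; the other
  -- `e` positions of the period follow.
  concentrated-at : ∀ t t′ → d + t′ ≡ t → F (t + 6) ≡ true → none-on 6 t ≡ true →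
                    F (t′ + 6 + d) ≡ true × M ≤ 441 + #[ F ] (suc (t′ + 6 + d)) e
  concentrated-at t t′ d+t′≡t Ft gapt = Fc , bound
    where
    t≡ : t ≡ t′ + d
    t≡ = trans (sym d+t′≡t) (+-comm d t′)
    Fc : F (t′ + 6 + d) ≡ true
    Fc = at {chord} (linear (t ∷ t′ ∷ d ∷ []) (λ t t′ d → 1 · t ≡′ t′ ⊕ d ⇒ goal (t ⊕ # 6 ≡′ t′ ⊕ # 6 ⊕ d)) t≡) Ft
    few : #[ F ] (t′ + 7) d ≤ 441
    few = few-without-runs t′ d
      (linear (d″ ∷ e″ ∷ n ∷ []) (λ d e n → 1 · # 2 ⊕ d ⊕ (# 2 ⊕ e) ≤′ n ⇒ goal (# 2 ⊕ d ≤′ n)) n≥d+e)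
      λ {x} l u run → let α , x≡ , α<d = offset l u in
        chord-avoids-end t′ Fc (subst (λ y → none-on 6 y ≡ true) t≡ gapt) α<d
          (subst (λ y → all-on 8 y ≡ true) x≡ run)
    bound : M ≤ 441 + #[ F ] (suc (t′ + 6 + d)) e
    bound = ≤-trans (≤-reflexive (trans (sym (count-on chord (t′ + 7)))
      (trans (cong (#[ F ] (t′ + 7)) n≡d+e) (trans (∑-split (λ x → ι (F x)) (t′ + 7) d e)
        (cong (λ y → #[ F ] (t′ + 7) d + #[ F ] y e)
          (linear (t′ ∷ d ∷ []) λ t d → goal (t ⊕ # 7 ⊕ d ≡′ # 1 ⊕ (t ⊕ # 6 ⊕ d))))))))
      (+-monoˡ-≤ _ few)

  concentrated : ∃[ c ] (F c ≡ true × M ≤ 441 + #[ F ] (suc c) e)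
  concentrated =
    -- Searching from `d` on ensures that `t - d` exists.
    case long-gap d of λ (g , d≤g , _ , gap) →
    case member F (g + 6) n (chord-nonempty (g + 6)) of λ (y , l , u , Fy) →
    case offset l u of λ (k , y≡ , _) →
    case first-after-gap k g gap (at {chord} y≡ Fy) of λ (t , g≤t , Ft , gapt) →
    case m≤n⇒∃[o]m+o≡n (≤-trans d≤g g≤t) of λ (t′ , d+t′≡t) →
    t′ + 6 + d , concentrated-at t t′ d+t′≡t Ft gapt

  e-large : M ≤ 441 + e
  e-large = case concentrated of λ (c , _ , h) → ≤-trans h (+-monoʳ-≤ 441 (count≤length F (suc c) e))

  -- From `c + 8` on, `chord-avoids-start` leaves at most 441 positions of `f` among the first
  -- `e - 7`; the rest of the period has only `7 + d` positions.
  d-large-at : ∀ c L → F c ≡ true → none-on 6 (suc c) ≡ true → 7 + L ≡ e → M ≤ 448 + d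
  d-large-at c L Fc gapc 7+L≡e =
    linear (M ∷ #[ F ] (suc c + 7) L ∷ #[ F ] (suc c + 7 + L) (7 + d) ∷ d ∷ [])
      (λ M s r d → 1 · M ≡′ s ⊕ r ⇒ 1 · s ≤′ # 441 ⇒ 1 · r ≤′ # 7 ⊕ d ⇒ goal (M ≤′ # 448 ⊕ d))
      (trans (sym (count-on chord (suc c + 7))) (trans (cong (#[ F ] (suc c + 7)) n≡) (∑-split _ (suc c + 7) L (7 + d))))
      (few-without-runs (suc c) L (≤-trans (m≤m+n L (7 + d)) (≤-reflexive (sym n≡)))
        λ {x} l u run → chord-avoids-start c Fc gapc l
          (linear (x ∷ c ∷ L ∷ e ∷ []) (λ x c L e → 1 · x <′ # 1 ⊕ c ⊕ L ⇒ 1 · # 7 ⊕ L ≤′ e ⇒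
            goal (x ⊕ # 7 ≤′ c ⊕ e)) u (≤-reflexive 7+L≡e)) run)
      (count≤length F _ (7 + d))
    where
    n≡ : n ≡ L + (7 + d)
    n≡ = linear (n ∷ L ∷ d ∷ e ∷ []) (λ n L d e → 1 · e ≡′ # 7 ⊕ L ⇒ 1 · n ≡′ d ⊕ e ⇒ goal (n ≡′ L ⊕ (# 7 ⊕ d)))
      (sym 7+L≡e) n≡d+e

  d-large : M ≤ 448 + d
  d-large =
    case member F 0 n (chord-nonempty 0) of λ (p , _ , p<n , Fp) →
    case long-gap (1 + n) of λ (g , n<g , _ , gap) →
    case m≤n⇒∃[o]m+o≡n (≤-trans (s≤s (<⇒≤ p<n)) n<g) of λ (k , p+k≡g) →
    case last-before-gap k p Fp (subst (λ y → none-on 6 y ≡ true) (sym p+k≡g) gap) of λ (c , Fc , gapc) →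
    case m≤n⇒∃[o]m+o≡n 7≤e of λ (L , 7+L≡e) →
    d-large-at c L Fc gapc 7+L≡e
    where
    7≤e : 7 ≤ e
    7≤e = linear (M ∷ e ∷ []) (λ M e → 1 · M ≤′ # 441 ⊕ e ⇒ 1 · # 5000 ≤′ M ⇒ goal (# 7 ≤′ e)) e-large large

  -- Each position of f near c excludes two positions from h_w, where w = c - 901
  -- modulo n; the offset only has to exceed the earlier error terms.
  contradiction-at : ∀ {c κ₁ r r₂ D₁ w} → F c ≡ true → M ≤ 441 + #[ F ] (suc c) e →
    901 + κ₁ ≡ d → κ₁ + r ≡ e → F (suc c + κ₁ + D₁) ≡ true → D₁ < r → suc D₁ + r₂ ≡ e →
    901 + w ≡ c + n → ⊥
  contradiction-at {c} {κ₁} {r} {r₂} {D₁} {w} Fc conc 901+κ₁≡d κ₁+r≡e Fv D₁<r D+r₂≡e 901+w≡c+n = linear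
      (M ∷ D ∷ κ₁ ∷ r₂ ∷ n ∷ d ∷ e ∷ r ∷ #[ G ] c D ∷ #[ G ] (c + D) κ ∷ #[ G ] (c + D + κ) r₂ ∷
       #[ G ] (c + D + κ + r₂) 900 ∷ #[ F ] c κ ∷ #[ F ] (suc c + D) r₂ ∷ #[ F ] (suc c) e ∷
       #[ F ] (suc c) κ₁ ∷ #[ F ] (suc c + κ₁) r ∷ #[ F ] (suc c) D ∷ [])
      (λ M D κ₁ r₂ n d e r h₁ h₂ h₃ h₄ f₁ f₂ s s₁ s₂ s₃ →
        -- Here `D ≤ r = e - d + 901 ≤ 1799`. The two zones exclude at least `2M - 882 - 2r`, hence
        -- at least `2M - 4480`, positions from `h_w`, which leaves `M ≤ 4482`.
        1 · M ≤′ h₁ ⊕ h₂ ⊕ h₃ ⊕ h₄ ⇒ 1 · h₁ ≤′ D ⇒ 1 · h₂ ⊕ f₁ ≤′ # 1 ⊕ κ₁ ⇒ 1 · h₃ ⊕ f₂ ≤′ r₂ ⇒ 1 · h₄ ≤′ # 900 ⇒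
        2 · M ≤′ # 441 ⊕ s ⇒ 1 · s ≤′ s₁ ⊕ s₂ ⇒ 1 · s₂ ≤′ r ⇒ 1 · s₁ ≤′ f₁ ⇒
        1 · s ≤′ s₃ ⊕ f₂ ⇒ 1 · s₃ ≤′ D ⇒ 1 · D ≤′ r ⇒ 1 · D ⊕ r₂ ≤′ e ⇒ 2 · κ₁ ⊕ r ≤′ e ⇒
        1 · # 901 ⊕ κ₁ ≤′ d ⇒ 2 · d ≤′ # 901 ⊕ κ₁ ⇒ 3 · d ⊕ e ≤′ n ⇒ 3 · n ≤′ # 2 ⊕ M ⊕ M ⇒
        4 · M ≤′ # 448 ⊕ d ⇒ 1 · # 5000 ≤′ M ⇒ goal false′)
      (≤-reflexive G-total) (count≤length G c D) zone₁ zone₂ (count≤length G _ 900)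
      conc (≤-reflexive (trans (cong (#[ F ] (suc c)) (sym κ₁+r≡e)) (∑-split _ (suc c) κ₁ r)))
      (count≤length F _ r) (m≤n+m _ (ι (F c)))
      (≤-reflexive (trans (cong (#[ F ] (suc c)) (sym D+r₂≡e)) (∑-split _ (suc c) D r₂)))
      (count≤length F _ D) D₁<r (≤-reflexive D+r₂≡e) (≤-reflexive κ₁+r≡e)
      (≤-reflexive 901+κ₁≡d) (≤-reflexive (sym 901+κ₁≡d)) n≥d+e (≤-reflexive n≡2M+2) d-large large
    where
    D κ : ℕ
    D = suc D₁
    κ = suc κ₁
    G : ℕ → Bool
    G = on (rim w)
    g : ℕ → ℕ
    g x = ι (G x)
    n≡ : n ≡ 901 + κ₁ + (D + r₂)
    n≡ = trans n≡d+e (cong₂ _+_ (sym 901+κ₁≡d) (sym D+r₂≡e))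
    w≡ : 901 + w ≡ c + (901 + κ₁ + (D + r₂))
    w≡ = trans 901+w≡c+n (cong (c +_) n≡)
    G-total : M ≡ #[ G ] c D + #[ G ] (c + D) κ + #[ G ] (c + D + κ) r₂ + #[ G ] (c + D + κ + r₂) 900
    G-total = trans (sym (count-on (rim w) c)) (trans (cong (#[ G ] c)
        (trans n≡ (linear (κ₁ ∷ D ∷ r₂ ∷ []) λ κ D r → goal (# 901 ⊕ κ ⊕ (D ⊕ r) ≡′ D ⊕ (# 1 ⊕ κ) ⊕ r ⊕ # 900))))
      (trans (∑-split g c (D + κ + r₂) 900) (cong₂ _+_
        (trans (∑-split g c (D + κ) r₂) (cong₂ _+_ (∑-split g c D κ)
          (cong (λ y → #[ G ] y r₂) (sym (+-assoc c D κ)))))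
        (cong (λ y → #[ G ] y 900) (linear (c ∷ D ∷ κ ∷ r₂ ∷ []) λ c D κ r → goal (c ⊕ (D ⊕ κ ⊕ r) ≡′ c ⊕ D ⊕ κ ⊕ r))))))
    900+κ₁≡1+d″ : 900 + κ₁ ≡ suc d″
    900+κ₁≡1+d″ = suc-injective 901+κ₁≡d

    -- Let `v = c + κ₁ + D`, a position of `f`. The excluded cycle is
    -- `w+1 ⋯ y+n —f— v+n ⋯ y+D+n —h_w— w+1`, the second arc descending, with `902 + κ₁ = d + 1`
    -- vertices for every `y`.
    zone₁ : #[ G ] (c + D) κ + #[ F ] c κ ≤ κ
    zone₁ = linear (#[ G ] (c + D) κ ∷ #[ F ] c κ ∷ #[ (λ y → nor (F y) (G (y + D))) ] c κ ∷
                    #[ (λ y → G (y + D)) ] c κ ∷ κ ∷ [])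
      (λ g f N g′ κ → 1 · N ⊕ f ⊕ g′ ≤′ κ ⇒ 1 · g ≤′ g′ ⇒ goal (g ⊕ f ≤′ κ))
      (≤-reflexive (count-nor F (λ y → G (y + D)) c κ excluded))
      (≤-reflexive (sym (∑-shift (λ y → ι (G y)) D c κ)))
      where
      excluded : ∀ {y} → c ≤ y → y < c + κ → F y ≡ true → G (y + D) ≡ true → ⊥
      excluded l u Fy Gy with offset l u
      ... | a , refl , a<κ with m≤n⇒∃[o]m+o≡n a<κ
      ... | b , a+b≡κ = no-cycle (subst (BergeCycle H)
        (linear (a ∷ b ∷ κ₁ ∷ d″ ∷ []) (λ a b κ d → 1 · # 1 ⊕ a ⊕ b ≡′ # 1 ⊕ κ ⇒ 1 · # 900 ⊕ κ ≡′ # 1 ⊕ d ⇒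
          goal (# 2 ⊕ (# 900 ⊕ a) ⊕ b ≡′ # 3 ⊕ d)) a+b≡κ 900+κ₁≡1+d″)
        (crossing-cycle {suc w} {900 + a} {c + a + D + n} {b}
          (linear (w ∷ a ∷ c ∷ D₁ ∷ n ∷ []) (λ w a c D n → 1 · # 901 ⊕ w ≤′ c ⊕ n ⇒
            goal (# 1 ⊕ w ⊕ (# 900 ⊕ a) <′ c ⊕ a ⊕ (# 1 ⊕ D) ⊕ n)) (≤-reflexive 901+w≡c+n))
          (s≤s s+b≤w+n)
          chord (rim (w + n)) tt (inj₂ (s+b≤w+n , ≤-refl)) (λ ())
          (at {chord} (linear (w ∷ a ∷ c ∷ n ∷ []) (λ w a c n → 1 · c ⊕ n ≡′ # 901 ⊕ w ⇒
            goal (c ⊕ a ⊕ n ≡′ # 1 ⊕ w ⊕ (# 900 ⊕ a))) (sym 901+w≡c+n)) (lap {chord} Fy))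
          (at {chord} (linear (a ∷ b ∷ c ∷ D₁ ∷ κ₁ ∷ n ∷ []) (λ a b c D κ n → 1 · # 1 ⊕ κ ≡′ # 1 ⊕ a ⊕ b ⇒
            goal (# 1 ⊕ c ⊕ κ ⊕ D ⊕ n ≡′ c ⊕ a ⊕ (# 1 ⊕ D) ⊕ n ⊕ b)) (sym a+b≡κ)) (lap {chord} Fv))
          (rim-lap {w} (lap {rim w} Gy)) (rim-lap {w} right-on)))
        where
        s+b≤w+n : c + a + D + n + b ≤ w + n
        s+b≤w+n = linear (a ∷ b ∷ c ∷ D₁ ∷ κ₁ ∷ r₂ ∷ w ∷ n ∷ []) (λ a b c D κ r w n →
          1 · # 1 ⊕ a ⊕ b ≤′ # 1 ⊕ κ ⇒ 1 · c ⊕ (# 901 ⊕ κ ⊕ (# 1 ⊕ D ⊕ r)) ≤′ # 901 ⊕ w ⇒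
          goal (c ⊕ a ⊕ (# 1 ⊕ D) ⊕ n ⊕ b ≤′ w ⊕ n)) (≤-reflexive a+b≡κ) (≤-reflexive (sym w≡))

    -- The excluded cycle is `w+1 ⋯ c+n —f— y+n ⋯ y+κ₁+n —h_w— w+1`.
    zone₂ : #[ G ] (c + D + κ) r₂ + #[ F ] (suc c + D) r₂ ≤ r₂
    zone₂ = linear (#[ G ] (c + D + κ) r₂ ∷ #[ F ] (suc c + D) r₂ ∷ #[ (λ y → nor (F y) (G (y + κ₁))) ] (suc c + D) r₂ ∷
                    #[ (λ y → G (y + κ₁)) ] (suc c + D) r₂ ∷ r₂ ∷ [])
      (λ g f N g′ r → 1 · N ⊕ f ⊕ g′ ≤′ r ⇒ 1 · g ≤′ g′ ⇒ goal (g ⊕ f ≤′ r))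
      (≤-reflexive (count-nor F (λ y → G (y + κ₁)) (suc c + D) r₂ excluded))
      (≤-reflexive (sym (trans (∑-shift (λ y → ι (G y)) κ₁ (suc c + D) r₂)
        (cong (λ y → #[ G ] y r₂) (sym (+-suc (c + D) κ₁))))))
      where
      excluded : ∀ {y} → suc c + D ≤ y → y < suc c + D + r₂ → F y ≡ true → G (y + κ₁) ≡ true → ⊥
      excluded {y} l u Fy Gy = no-cycle (subst (BergeCycle H)
        (linear (κ₁ ∷ d″ ∷ []) (λ κ d → 1 · # 900 ⊕ κ ≡′ # 1 ⊕ d ⇒ goal (# 902 ⊕ κ ≡′ # 3 ⊕ d)) 900+κ₁≡1+d″)
        (parallel-cycle {suc w} {900} {y + n} {κ₁}
          (linear (w ∷ c ∷ D ∷ y ∷ n ∷ []) (λ w c D y n → 1 · # 901 ⊕ w ≤′ c ⊕ n ⇒ 1 · # 1 ⊕ c ⊕ D ≤′ y ⇒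
            goal (# 1 ⊕ w ⊕ # 900 <′ y ⊕ n)) (≤-reflexive 901+w≡c+n) l)
          (s≤s s+b≤w+n)
          chord (rim (w + n)) tt (inj₂ (s+b≤w+n , ≤-refl)) (λ ())
          (at {chord} (linear (w ∷ c ∷ n ∷ []) (λ w c n → 1 · c ⊕ n ≡′ # 901 ⊕ w ⇒
            goal (c ⊕ n ≡′ # 1 ⊕ w ⊕ # 900)) (sym 901+w≡c+n)) (lap {chord} Fc))
          (lap {chord} Fy)
          (rim-lap {w} (at {rim w} (linear (y ∷ κ₁ ∷ n ∷ []) λ y κ n → goal (y ⊕ κ ⊕ n ≡′ y ⊕ n ⊕ κ)) (lap {rim w} Gy)))
          (rim-lap {w} right-on)))
        where
        s+b≤w+n : y + n + κ₁ ≤ w + n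
        s+b≤w+n = linear (y ∷ c ∷ D ∷ κ₁ ∷ r₂ ∷ w ∷ n ∷ []) (λ y c D κ r w n →
          1 · y <′ # 1 ⊕ c ⊕ D ⊕ r ⇒ 1 · c ⊕ (# 901 ⊕ κ ⊕ (D ⊕ r)) ≤′ # 901 ⊕ w ⇒
          goal (y ⊕ n ⊕ κ ≤′ w ⊕ n)) u (≤-reflexive (sym w≡))

  contradiction : ⊥
  contradiction =
    case concentrated of λ (c , Fc , conc) →
    case m≤n⇒∃[o]m+o≡n d≥901 of λ (κ₁ , 901+κ₁≡d) →
    case m≤n⇒∃[o]m+o≡n (κ₁≤e κ₁ 901+κ₁≡d) of λ (r , κ₁+r≡e) →
    case member F (suc c + κ₁) r (v-exists c κ₁ r conc 901+κ₁≡d κ₁+r≡e) of λ (v , l , u , Fv) →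
    case offset l u of λ (D₁ , v≡ , D₁<r) →
    case m≤n⇒∃[o]m+o≡n (≤-trans D₁<r (≤-trans (m≤n+m r κ₁) (≤-reflexive κ₁+r≡e))) of λ (r₂ , D+r₂≡e) →
    case m≤n⇒∃[o]m+o≡n (≤-trans 901≤n (m≤n+m n c)) of λ (w , 901+w≡c+n) →
    contradiction-at Fc conc 901+κ₁≡d κ₁+r≡e (at {chord} v≡ Fv) D₁<r D+r₂≡e 901+w≡c+n
    where
    d≥901 : 901 ≤ d
    d≥901 = linear (M ∷ d ∷ []) (λ M d → 1 · M ≤′ # 448 ⊕ d ⇒ 1 · # 5000 ≤′ M ⇒ goal (# 901 ≤′ d)) d-large large
    901≤n : 901 ≤ n
    901≤n = linear (d ∷ e ∷ n ∷ []) (λ d e n → 1 · # 901 ≤′ d ⇒ 1 · d ⊕ e ≤′ n ⇒ goal (# 901 ≤′ n)) d≥901 n≥d+e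
    κ₁≤e : ∀ κ₁ → 901 + κ₁ ≡ d → κ₁ ≤ e
    κ₁≤e κ₁ q = linear (M ∷ n ∷ κ₁ ∷ d ∷ e ∷ []) (λ M n κ d e → 1 · # 901 ⊕ κ ≤′ d ⇒ 1 · d ⊕ e ≤′ n ⇒
      1 · n ≤′ # 2 ⊕ M ⊕ M ⇒ 2 · M ≤′ # 441 ⊕ e ⇒ goal (κ ≤′ e))
      (≤-reflexive q) n≥d+e (≤-reflexive n≡2M+2) e-large
    -- All but 441 positions of `f` lie in the `e` places after `c`, and since `d ≤ M + 443`, the
    -- first `κ₁ = d - 901` of these places cannot hold so many.
    v-exists : ∀ c κ₁ r → M ≤ 441 + #[ F ] (suc c) e → 901 + κ₁ ≡ d → κ₁ + r ≡ e → 1 ≤ #[ F ] (suc c + κ₁) r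
    v-exists c κ₁ r conc q κ₁+r≡e =
      linear (M ∷ n ∷ κ₁ ∷ d ∷ e ∷ #[ F ] (suc c) e ∷ #[ F ] (suc c) κ₁ ∷ #[ F ] (suc c + κ₁) r ∷ [])
      (λ M n κ d e s s₁ s₂ → 1 · M ≤′ # 441 ⊕ s ⇒ 1 · s ≤′ s₁ ⊕ s₂ ⇒ 1 · s₁ ≤′ κ ⇒ 1 · # 901 ⊕ κ ≤′ d ⇒
        1 · d ⊕ e ≤′ n ⇒ 1 · n ≤′ # 2 ⊕ M ⊕ M ⇒ 1 · M ≤′ # 441 ⊕ e ⇒ goal (# 1 ≤′ s₂))
      conc (≤-reflexive (trans (cong (#[ F ] (suc c)) (sym κ₁+r≡e)) (∑-split _ (suc c) κ₁ r)))
      (count≤length F (suc c) κ₁) (≤-reflexive q) n≥d+e (≤-reflexive n≡2M+2) e-large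

-- Short cycles

member₂ : ∀ b a k → 2 ≤ #[ b ] a k → ∃[ x ] ∃[ y ] (a ≤ x × x < y × y < a + k × b x ≡ true × b y ≡ true)
member₂ b a (suc k) h with b a in eq
... | true = case member b (suc a) k (≤-pred h) of λ (y , l , u , by) →
      a , y , ≤-refl , l , proj₂ (tail-bound l u) , eq , by
... | false = case member₂ b (suc a) k h of λ (x , y , l , x<y , u , bx , by) →
      x , y , <⇒≤ l , x<y , proj₂ (tail-bound (<⇒≤ (≤-<-trans l x<y)) u) , bx , by

-- For a position in `j` of the three sets, `j ≤ 1 + j(j-1)/2`.
three-sets : ∀ (p q r : ℕ → Bool) a k → #[ p ] a k + #[ q ] a k + #[ r ] a k ≤
  k + (#[ (λ x → p x ∧ q x) ] a k + #[ (λ x → p x ∧ r x) ] a k + #[ (λ x → q x ∧ r x) ] a k)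
three-sets p q r a k = begin
  #[ p ] a k + #[ q ] a k + #[ r ] a k
    ≡⟨ sum₃ p q r ⟨
  ∑ (λ x → ι (p x) + ι (q x) + ι (r x)) a k
    ≤⟨ ∑-mono a k (λ {x} _ _ → bits (p x) (q x) (r x)) ⟩
  ∑ (λ x → 1 + (ι (p x ∧ q x) + ι (p x ∧ r x) + ι (q x ∧ r x))) a k
    ≡⟨ ∑-+ (λ _ → 1) (λ x → ι (p x ∧ q x) + ι (p x ∧ r x) + ι (q x ∧ r x)) a k ⟩
  ∑ (λ _ → 1) a k + ∑ (λ x → ι (p x ∧ q x) + ι (p x ∧ r x) + ι (q x ∧ r x)) a k
    ≡⟨ cong₂ _+_ (trans (∑-const 1 a k) (*-identityʳ k))
         (sum₃ (λ x → p x ∧ q x) (λ x → p x ∧ r x) (λ x → q x ∧ r x)) ⟩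
  k + (#[ (λ x → p x ∧ q x) ] a k + #[ (λ x → p x ∧ r x) ] a k + #[ (λ x → q x ∧ r x) ] a k) ∎
  where
  open ≤-Reasoning
  sum₃ : ∀ (p q r : ℕ → Bool) → ∑ (λ x → ι (p x) + ι (q x) + ι (r x)) a k ≡ #[ p ] a k + #[ q ] a k + #[ r ] a k
  sum₃ p q r = trans (∑-+ (λ x → ι (p x) + ι (q x)) (λ x → ι (r x)) a k)
    (cong (_+ #[ r ] a k) (∑-+ (λ x → ι (p x)) (λ x → ι (q x)) a k))
  bits : ∀ p q r → ι p + ι q + ι r ≤ 1 + (ι (p ∧ q) + ι (p ∧ r) + ι (q ∧ r))
  bits true true true = s≤s (s≤s (s≤s z≤n))
  bits true true false = ≤-refl
  bits true false true = ≤-refl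
  bits true false false = ≤-refl
  bits false true true = ≤-refl
  bits false true false = ≤-refl
  bits false false true = ≤-refl
  bits false false false = z≤n

module ShortContradiction {n : ℕ} {H : Hypergraph n} (U : Unrolled H) (M : ℕ) (n≡2M+2 : n ≡ 2 + M + M)
  (size : ∀ g → #[ Cycles.on U g ] 0 n ≡ M)
  (d′ e′ : ℕ) (n≡d+e : n ≡ suc d′ + suc e′) (no-cycle : ¬ BergeCycle H (2 + d′))
  (small : 3 * (2 + d′) ≤ M) where
  open Unrolled U
  open Cycles U
  open NoCycle U M n≡2M+2 size d′ e′ n≡d+e no-cycle

  both : Label → Label → ℕ → Bool
  both g g′ x = on g x ∧ on g′ x

  both-true : ∀ g g′ {x} → both g g′ x ≡ true → on g x ≡ true × on g′ x ≡ true
  both-true g g′ {x} h with on g x | on g′ x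
  both-true g g′ h | true | true = refl , refl

  Close : Label → Label → Set
  Close g g′ = 2 + d′ ≤ #[ both g g′ ] 0 n

  Near : ℕ → Set
  Near i = Close chord (rim i)

  close-beyond : ∀ {g g′} → Close g g′ → ∀ a k l → n ≡ k + l → 2 + d′ ≤ k + #[ both g g′ ] (a + k) l
  close-beyond {g} {g′} h a k l n≡ = ≤-trans h (≤-trans (≤-reflexive
    (trans (∑-periodic _ n (λ x → cong₂ (λ a b → ι (a ∧ b)) (on-periodic g x) (on-periodic g′ x)) 0 a)
      (trans (cong (#[ both g g′ ] a) n≡) (∑-split (λ x → ι (both g g′ x)) a k l))))
    (+-monoˡ-≤ _ (count≤length (both g g′) a k)))

  -- With `ℓ = 2 + d′`, failure would give `3M ≤ n + 3(ℓ - 1)`, that is `M < 3ℓ`.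
  some-close : ∀ g₁ g₂ g₃ → ¬ Close g₂ g₃ → Close g₁ g₂ ⊎ Close g₁ g₃
  some-close g₁ g₂ g₃ ¬23 with 2 + d′ ≤? #[ both g₁ g₂ ] 0 n | 2 + d′ ≤? #[ both g₁ g₃ ] 0 n
  ... | yes c | _ = inj₁ c
  ... | no _ | yes c = inj₂ c
  ... | no ¬12 | no ¬13 = ⊥-elim (linear
      (M ∷ n ∷ d′ ∷ #[ both g₁ g₂ ] 0 n ∷ #[ both g₁ g₃ ] 0 n ∷ #[ both g₂ g₃ ] 0 n ∷
       #[ on g₁ ] 0 n ∷ #[ on g₂ ] 0 n ∷ #[ on g₃ ] 0 n ∷ [])
      (λ M n d s₁ s₂ s₃ t₁ t₂ t₃ → 1 · t₁ ⊕ t₂ ⊕ t₃ ≤′ n ⊕ (s₁ ⊕ s₂ ⊕ s₃) ⇒ 1 · M ≡′ t₁ ⇒ 1 · M ≡′ t₂ ⇒ 1 · M ≡′ t₃ ⇒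
        1 · s₁ <′ # 2 ⊕ d ⇒ 1 · s₂ <′ # 2 ⊕ d ⇒ 1 · s₃ <′ # 2 ⊕ d ⇒ 1 · n ≡′ # 2 ⊕ M ⊕ M ⇒
        1 · 3 ⊗ (# 2 ⊕ d) ≤′ M ⇒ goal false′)
      (three-sets (on g₁) (on g₂) (on g₃) 0 n) (sym (size g₁)) (sym (size g₂)) (sym (size g₃))
      (≰⇒> ¬12) (≰⇒> ¬13) (≰⇒> ¬23) n≡2M+2 small)

  -- The cycle is `i+1 ⋯ i+d —h_{i+d}— z —h_i— i+1`, with `z` a shared vertex outside the arc of `d`
  -- positions.
  rims-not-close : ∀ i → ¬ Close (rim i) (rim (i + d))
  rims-not-close i c =
    case member (both (rim i) (rim (i + d))) (suc i + d) e beyond of λ (z , l , u , bz) →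
    case both-true (rim i) (rim (i + d)) {z} bz of λ (iz , jz) →
    let z<p+n : z < suc i + n
        z<p+n = subst (z <_) (trans (+-assoc (suc i) d e) (cong (suc i +_) (sym n≡d+e))) u in
    no-cycle (subst (BergeCycle H) (+-identityʳ (2 + d′)) (parallel-cycle {suc i} {d′} {z} {0}
      (≤-trans (s≤s (≤-reflexive (sym (+-suc i d′)))) l)
      (subst (_< suc i + n) (sym (+-identityʳ z)) z<p+n)
      (rim (i + d)) (rim (i + n))
      (inj₁ (≤-reflexive (sym (+-suc i d′)) , l))
      (inj₂ (subst (_≤ i + n) (sym (+-identityʳ z)) (≤-pred z<p+n) , ≤-refl))
      (λ q → <⇒≢ (linear (i ∷ d′ ∷ e′ ∷ n ∷ []) (λ i d e n → 1 · # 1 ⊕ d ⊕ (# 1 ⊕ e) ≡′ n ⇒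
        goal (i ⊕ (# 1 ⊕ d) <′ i ⊕ n)) (sym n≡d+e)) (rim-injective q))
      (at {rim (i + d)} (+-suc i d′) left-on) jz
      (at {rim (i + n)} (sym (+-identityʳ z)) (rim-lap {i} iz)) (rim-lap {i} right-on)))
    where
    beyond : 1 ≤ #[ both (rim i) (rim (i + d)) ] (suc i + d) e
    beyond = +-cancelˡ-≤ d _ _ (subst (_≤ d + #[ both (rim i) (rim (i + d)) ] (suc i + d) e) (+-comm 1 d)
      (close-beyond {rim i} {rim (i + d)} c (suc i) d e n≡d+e))

  near-or-near : ∀ i → Near i ⊎ Near (i + d)
  near-or-near i = some-close chord (rim i) (rim (i + d)) (rims-not-close i)

  near-lap : ∀ i → Near i → Near (i + n)
  near-lap i = subst (2 + d′ ≤_) (∑-cong 0 n λ {x} _ _ → cong (λ b → ι (on chord x ∧ b)) (sym (rim-periodic i x)))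

  -- The case `ℓ = 2`: two common vertices of `f` and `h_i` already form the cycle.
  no-near-digon : d′ ≡ 0 → ∀ i → ¬ Near i
  no-near-digon refl i c =
    case member₂ (both chord (rim i)) (suc i + 0) n (close-beyond {chord} {rim i} c (suc i) 0 n refl) of
      λ (x , y , l , x<y , u , bx , by) →
    case both-true chord (rim i) {x} bx of λ (fx , ix) →
    case both-true chord (rim i) {y} by of λ (fy , iy) →
    let i<x = subst (_≤ x) (+-identityʳ (suc i)) l
        y≤i+n = ≤-pred (subst (λ z → y < z + n) (+-identityʳ (suc i)) u) in
    no-cycle (parallel-cycle {x} {0} {y} {0}
      (subst (_< y) (sym (+-identityʳ x)) x<y)
      (subst (_< x + n) (sym (+-identityʳ y)) (≤-<-trans y≤i+n (+-monoˡ-< n i<x)))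
      chord (rim (i + n)) tt (inj₂ (subst (_≤ i + n) (sym (+-identityʳ y)) y≤i+n , +-monoˡ-< n i<x)) (λ ())
      (at {chord} (sym (+-identityʳ x)) fx) fy
      (at {rim (i + n)} (sym (+-identityʳ y)) (rim-lap {i} iy)) (rim-lap {i} ix))

  -- The cycle is `i+1 ⋯ i+d′ —h_{i+d′}— z —f— z₂ —h_i— i+1`. Each of the two rim edges shares at
  -- least two vertices with `f` outside the arc, so `z` and `z₂` can be chosen distinct.
  not-both-near : ∀ δ → d′ ≡ suc δ → ∀ i → Near i → Near (i + d′) → ⊥
  not-both-near δ refl i near₀ near₁ =
    case member₂ (both chord (rim i)) (suc i + d′) (suc e) (beyond near₀) of
      λ (x , y , l , x<y , u , bx , by) →
    case member₂ (both chord (rim (i + d′))) (suc i + d′) (suc e) (beyond near₁) of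
      λ (z , _ , l′ , z<z′ , u′ , bz , _) →
    case z ≟ x of λ
      { (no z≢x) → build z≢x l (<-trans x<y u) bx l′ (<-trans z<z′ u′) bz
      ; (yes z≡x) → build (λ z≡y → <⇒≢ x<y (trans (sym z≡x) z≡y)) (<⇒≤ (≤-<-trans l x<y)) u by l′ (<-trans z<z′ u′) bz }
    where
    n≡ : n ≡ d′ + suc e
    n≡ = trans n≡d+e (sym (+-suc d′ e))
    beyond : ∀ {j} → Near j → 2 ≤ #[ both chord (rim j) ] (suc i + d′) (suc e)
    beyond {j} c = +-cancelˡ-≤ d′ _ _ (subst (_≤ d′ + #[ both chord (rim j) ] (suc i + d′) (suc e)) (+-comm 2 d′)
      (close-beyond {chord} {rim j} c (suc i) d′ (suc e) n≡))
    build : ∀ {z z₂} → z ≢ z₂ → suc i + d′ ≤ z₂ → z₂ < suc i + d′ + suc e → both chord (rim i) z₂ ≡ true →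
            suc i + d′ ≤ z → z < suc i + d′ + suc e → both chord (rim (i + d′)) z ≡ true → ⊥
    build {z} {z₂} z≢z₂ l₂ u₂ b₂ l₁ u₁ b₁ =
      case both-true chord (rim i) {z₂} b₂ of λ (f₂ , h₂) →
      case both-true chord (rim (i + d′)) {z} b₁ of λ (f₁ , h₁) →
      no-cycle (subst (BergeCycle H) (+-comm δ 3)
        (two-point-cycle (suc i) δ (rim (i + d′)) chord (rim (i + n)) {z} {z₂}
          (low l₁) (high u₁) (low l₂) (high u₂) z≢z₂
          (≤-reflexive p+a≡ , <-trans i+d′<i+n ≤-refl) tt
          (≤-trans (≤-reflexive p+a≡) (<⇒≤ i+d′<i+n) , ≤-refl)
          (λ ()) (λ q → >⇒≢ i+d′<i+n (rim-injective q)) (λ ())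
          (at {rim (i + d′)} (sym p+a≡) left-on) h₁ f₁ f₂ (rim-lap {i} h₂) (rim-lap {i} right-on)))
      where
      p+a≡ : suc i + δ ≡ i + d′
      p+a≡ = sym (+-suc i δ)
      i+d′<i+n : i + d′ < i + n
      i+d′<i+n = linear (i ∷ d′ ∷ e′ ∷ n ∷ []) (λ i d e n → 1 · # 1 ⊕ d ⊕ (# 1 ⊕ e) ≡′ n ⇒
        goal (i ⊕ d <′ i ⊕ n)) (sym n≡d+e)
      low : ∀ {y} → suc i + d′ ≤ y → suc i + δ < y
      low = ≤-trans (≤-reflexive (cong suc p+a≡))
      high : ∀ {y} → y < suc i + d′ + suc e → y < suc i + n
      high {y} = subst (y <_) (trans (+-assoc (suc i) d′ (suc e)) (cong (suc i +_) (sym n≡)))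

  contradiction : ⊥
  contradiction = by-length d′ refl
    where
    by-length : ∀ k → d′ ≡ k → ⊥
    by-length zero d′≡0 = case near-or-near 0 of λ
      { (inj₁ c) → no-near-digon d′≡0 0 c ; (inj₂ c) → no-near-digon d′≡0 d c }
    by-length (suc δ) d′≡ = case near-or-near 0 of λ
      { (inj₁ c) → everywhere 0 c ; (inj₂ c) → everywhere d c }
      where
      back : ∀ i → Near (suc i) → Near i
      back i c = case near-or-near i of λ
        { (inj₁ c′) → c′
        ; (inj₂ c′) → ⊥-elim (not-both-near δ d′≡ (suc i) c (subst Near (+-suc i d′) c′)) }
      descend : ∀ k i → Near (k + i) → Near i
      descend zero i c = c
      descend (suc k) i c = descend k i (back (k + i) c)
      everywhere : ∀ i → Near i → ⊥
      -- `i + n` lies `e + 1` steps after `i + d′`, so nearness descends from `i + n` to `i + d′`.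
      everywhere i c = not-both-near δ d′≡ i c (descend (suc e) (i + d′) (subst Near
        (linear (i ∷ n ∷ d′ ∷ e′ ∷ []) (λ i n d e → 1 · n ≡′ # 1 ⊕ d ⊕ (# 1 ⊕ e) ⇒
          goal (i ⊕ n ≡′ # 2 ⊕ e ⊕ (i ⊕ d))) n≡d+e) (near-lap i c)))

-- Unrolling a Hamiltonian cycle

Searchable : Set → Set₁
Searchable A = ∀ {P : A → Set} → (∀ x → Dec (P x)) → Dec (∃ P)

vec-searchable : ∀ {A} → Searchable A → ∀ k → Searchable (Vec A k)
vec-searchable search zero P? = map′ ([] ,_) (λ { ([] , p) → p }) (P? [])
vec-searchable search (suc k) P? =
  map′ (λ { (x , xs , p) → x ∷ xs , p }) (λ { (x ∷ xs , p) → x , xs , p })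
    (search λ x → vec-searchable search k λ xs → P? (x ∷ xs))

injective? : ∀ {A : Set} {k} → (∀ (x y : A) → Dec (x ≡ y)) → (f : Fin k → A) → Dec (Injective _≡_ _≡_ f)
injective? _≟ᴬ_ f = map′ (λ inj {i} {j} → inj i j) (λ inj i j → inj {i} {j})
  (Fin.all? λ i → Fin.all? λ j → (f i ≟ᴬ f j) →-dec (i Fin.≟ j))

-- Decidability permits the argument by contradiction in `pancyclic`. Vertices and edges are listed
-- in vectors, which can be searched exhaustively.
bergeCycle? : ∀ {n} (H : Hypergraph n) ℓ → Dec (BergeCycle H ℓ)
bergeCycle? {n} H ℓ = map′ to from
  (vec-searchable Fin.any? ℓ λ vs → vec-searchable anySubset? ℓ λ es →
    2 ≤? ℓ ×-dec injective? Fin._≟_ (Vec.lookup vs) ×-dec injective? _≟ˢ_ (Vec.lookup es) ×-dec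
    Fin.all? (λ i → edge? H (Vec.lookup es i)) ×-dec
    Fin.all? (λ i → (Vec.lookup vs i ∈? Vec.lookup es i) ×-dec (Vec.lookup vs (cyclicSuc i) ∈? Vec.lookup es i)))
  where
  to : _ → BergeCycle H ℓ
  to (vs , es , 2≤ , v-inj , e-inj , e∈ , inc) = record
    { 2≤ℓ = 2≤ ; vertex = Vec.lookup vs ; edge = Vec.lookup es ; vertex-injective = v-inj
    ; edge-injective = e-inj ; edge∈H = e∈ ; incident = inc }
  from : BergeCycle H ℓ → _
  from C = Vec.tabulate vertex , Vec.tabulate edge , 2≤ℓ ,
    (λ {i} {j} q → vertex-injective (trans (sym (lookup∘tabulate vertex i)) (trans q (lookup∘tabulate vertex j)))) ,
    (λ {i} {j} q → edge-injective (trans (sym (lookup∘tabulate edge i)) (trans q (lookup∘tabulate edge j)))) ,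
    (λ i → subst (Edge H) (sym (lookup∘tabulate edge i)) (edge∈H i)) ,
    λ i → subst₂ _∈ˢ_ (sym (lookup∘tabulate vertex i)) (sym (lookup∘tabulate edge i)) (proj₁ (incident i)) ,
          subst₂ _∈ˢ_ (sym (lookup∘tabulate vertex (cyclicSuc i))) (sym (lookup∘tabulate edge i)) (proj₂ (incident i))
    where open BergeCycle C

-- Residues and cardinalities

mod-cong : ∀ k i j → i % suc k ≡ j % suc k → i mod suc k ≡ j mod suc k
mod-cong k i j e = Fin.toℕ-injective (trans (Fin.toℕ-fromℕ< _) (trans e (sym (Fin.toℕ-fromℕ< _))))

cyclicSuc-mod : ∀ k i → cyclicSuc (i mod suc k) ≡ suc i mod suc k
cyclicSuc-mod k i = mod-cong k (suc (toℕ (i mod suc k))) (suc i) (trans (cong (λ r → suc r % suc k) (Fin.toℕ-fromℕ< _))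
  (trans (sym ([m+kn]%n≡m%n (suc (i % suc k)) (i / suc k) (suc k)))
    (cong (λ r → suc r % suc k) (sym (m≡m%n+[m/n]*n i (suc k))))))

-- With equal remainders the larger number has the larger quotient, so it is at least a period away.
mod-distinct : ∀ k {i j} → i < j → j < i + suc k → i mod suc k ≢ j mod suc k
mod-distinct k {i} {j} i<j j<i+n e = case <-cmp (i / suc k) (j / suc k) of λ
  { (tri< q<q′ _ _) → <⇒≱ j<i+n (≤-trans (≤-reflexive (cong (_+ suc k) (m≡m%n+[m/n]*n i (suc k))))
      (≤-trans (≤-reflexive (trans (+-assoc (i % suc k) _ (suc k)) (cong₂ _+_ r≡ (+-comm _ (suc k)))))
        (≤-trans (+-monoʳ-≤ (j % suc k) (*-monoˡ-≤ (suc k) q<q′)) (≤-reflexive (sym (m≡m%n+[m/n]*n j (suc k)))))))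
  ; (tri≈ _ q≡q′ _) → j≰i (≤-reflexive (sym q≡q′))
  ; (tri> _ _ q′<q) → j≰i (<⇒≤ q′<q) }
  where
  r≡ : i % suc k ≡ j % suc k
  r≡ = trans (sym (Fin.toℕ-fromℕ< _)) (trans (cong toℕ e) (Fin.toℕ-fromℕ< _))
  j≰i : ¬ (j / suc k ≤ i / suc k)
  j≰i q = <⇒≱ i<j (≤-trans (≤-reflexive (m≡m%n+[m/n]*n j (suc k)))
    (≤-trans (+-mono-≤ (≤-reflexive (sym r≡)) (*-monoˡ-≤ (suc k) q)) (≤-reflexive (sym (m≡m%n+[m/n]*n i (suc k))))))

∑-Fin : ∀ p k → ∑ p 0 k ≡ Sum.sum {k} (λ i → p (toℕ i))
∑-Fin p zero = refl
∑-Fin p (suc k) = cong (p 0 +_) (trans (sym (∑-suc p 0 k)) (∑-Fin (λ x → p (suc x)) k))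

∣∣-sum : ∀ {n} (s : Subset n) → ∣ s ∣ ≡ Sum.sum (λ i → ι (Vec.lookup s i))
∣∣-sum [] = refl
∣∣-sum (true ∷ s) = cong suc (∣∣-sum s)
∣∣-sum (false ∷ s) = ∣∣-sum s

module _ {n ℓ : ℕ} {H : Hypergraph n} (C : BergeCycle H ℓ) (hamiltonian : Hamiltonian C) where
  open BergeCycle C

  -- Gives `ℓ ≡ n`, and turns sums over positions into sums over vertices.
  vertices : Permutation ℓ n
  vertices = permutation vertex (λ v → proj₁ (hamiltonian v)) (λ v → proj₂ (hamiltonian v))
    (λ i → vertex-injective (proj₂ (hamiltonian (vertex i))))

module Unroll {k : ℕ} {H : Hypergraph (suc k)} (C : BergeCycle H (suc k)) (hamiltonian : Hamiltonian C)
              {f : Subset (suc k)} (f∈E∖C : f ∈ Edge H ∖ E C) where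
  open BergeCycle C

  withChord : Hypergraph (suc k)
  withChord = hypergraph (E C ∪ ｛ f ｝) (E? C ∪? (f ≟ˢ_))

  hamiltonianCycle : BergeCycle withChord (suc k)
  hamiltonianCycle = record
    { 2≤ℓ = 2≤ℓ ; vertex = vertex ; edge = edge ; vertex-injective = vertex-injective
    ; edge-injective = edge-injective ; edge∈H = λ i → inj₁ (i , refl) ; incident = incident }

  unrolled : Unrolled withChord
  unrolled = record
    { X = λ i → vertex (i mod suc k)
    ; h = λ i → edge (i mod suc k)
    ; f = f
    ; X-periodic = λ i → cong vertex (mod-cong k (i + suc k) i ([m+n]%n≡m%n i (suc k)))
    ; h-periodic = λ i → cong edge (mod-cong k (i + suc k) i ([m+n]%n≡m%n i (suc k)))
    ; X-distinct = λ l u e → mod-distinct k l u (vertex-injective e)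
    ; h-distinct = λ l u e → mod-distinct k l u (edge-injective e)
    ; h≢f = λ i e → proj₂ f∈E∖C (i mod suc k , e)
    ; left∈h = λ i → proj₁ (incident (i mod suc k))
    ; right∈h = λ i → subst (λ j → vertex j ∈ˢ edge (i mod suc k)) (cyclicSuc-mod k i) (proj₂ (incident (i mod suc k)))
    ; h∈H = λ i → inj₁ (i mod suc k , refl)
    ; f∈H = inj₂ refl
    }
  open Cycles unrolled

  on-size : ∀ g → #[ on g ] 0 (suc k) ≡ ∣ edgeOf g ∣
  on-size g = trans (∑-Fin (λ x → ι (on g x)) (suc k))
    (trans (Sum.sum-cong-≗ λ i → cong (λ j → ι (Vec.lookup (edgeOf g) (vertex j))) (toℕ-mod i))
      (trans (sym (Sum.sum-permute (λ v → ι (Vec.lookup (edgeOf g) v)) (vertices C hamiltonian)))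
        (sym (∣∣-sum (edgeOf g)))))
    where
    toℕ-mod : ∀ (i : Fin (suc k)) → toℕ i mod suc k ≡ i
    toℕ-mod i = Fin.toℕ-injective (trans (Fin.toℕ-fromℕ< _) (m<n⇒m%n≡m (Fin.toℕ<n i)))

  edgeOf∈Edge : ∀ g → edgeOf g ∈ Edge H
  edgeOf∈Edge (rim i) = edge∈H (i mod suc k)
  edgeOf∈Edge chord = proj₁ f∈E∖C

  pancyclic : ∀ M → Uniform H M → suc k ≡ 2 + M + M → 5000 ≤ M → BergePancyclic withChord
  pancyclic M uniform n≡ large L 2≤L L≤n with m≤n⇒m<n∨m≡n L≤n
  ... | inj₂ refl = hamiltonianCycle
  -- Below `n` the number `e = n - L + 1` is at least 2, as the long case requires.
  ... | inj₁ L<n = decidable-stable (bergeCycle? withChord L) λ no-cycle →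
    case m≤n⇒∃[o]m+o≡n 2≤L of λ (d′ , 2+d′≡L) →
    case m≤n⇒∃[o]m+o≡n L<n of λ (e″ , L+e″≡n) →
    absurd d′ e″ (linear (L ∷ d′ ∷ e″ ∷ suc k ∷ []) (λ L d e n → 1 · L ≡′ # 2 ⊕ d ⇒ 1 · n ≡′ # 1 ⊕ L ⊕ e ⇒
        goal (n ≡′ # 1 ⊕ d ⊕ (# 2 ⊕ e))) (sym 2+d′≡L) (sym L+e″≡n))
      (subst (λ ℓ → ¬ BergeCycle withChord ℓ) (sym 2+d′≡L) no-cycle)
    where
    size : ∀ g → #[ on g ] 0 (suc k) ≡ M
    size g = trans (on-size g) (uniform (edgeOf∈Edge g))
    absurd : ∀ d′ e″ → suc k ≡ suc d′ + suc (suc e″) → ¬ BergeCycle withChord (2 + d′) → ⊥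
    absurd d′ e″ n≡d+e no-cycle with 3 * (2 + d′) ≤? M
    ... | yes small = ShortContradiction.contradiction unrolled M n≡ size d′ (suc e″) n≡d+e no-cycle small
    absurd zero e″ n≡d+e no-cycle | no ¬small =
      linear (M ∷ []) (λ M → 1 · M <′ # 6 ⇒ 1 · # 5000 ≤′ M ⇒ goal false′) (≰⇒> ¬small) large
    absurd (suc d″) e″ n≡d+e no-cycle | no ¬small =
      LongContradiction.contradiction unrolled M n≡ size d″ e″ n≡d+e no-cycle n≤7d′ large
      where
      n≤7d′ : suc k ≤ 7 * suc d″
      -- As `M < 3 * (2 + d′)`, the number `n = 2 + M + M` exceeds `6 * d′` by at most a constant,
      -- which a seventh `d′` absorbs.
      n≤7d′ = ≮⇒≥ λ 7d′<n → linear (suc k ∷ M ∷ suc d″ ∷ []) (λ n M d → 3 · 7 ⊗ d <′ n ⇒ 3 · n ≤′ # 2 ⊕ M ⊕ M ⇒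
        7 · M <′ 3 ⊗ (# 2 ⊕ d) ⇒ 1 · # 5000 ≤′ M ⇒ goal false′) 7d′<n (≤-reflexive n≡) (≰⇒> ¬small) large

theorem1p5 : ∃ λ (m₀ : ℕ) → ∀ (m : ℕ) → m₀ ≤ m →
    ∀ (H : Hypergraph (2 * m)) → Uniform H (m ∸ 1) →
    ∀ (ℓ : ℕ) (C : BergeCycle H ℓ) → Hamiltonian C →
    ∀ (f : Subset (2 * m)) → f ∈ Edge H ∖ E C →
    BergePancyclic (hypergraph (E C ∪ ｛ f ｝) (E? C ∪? (f ≟ˢ_)))
theorem1p5 = 5001 , λ { (suc M) (s≤s large) H uniform ℓ C hamiltonian f f∈E∖C →
  main M large H uniform C hamiltonian (↔⇒≡ (vertices C hamiltonian)) f∈E∖C }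
  where
  main : ∀ M → 5000 ≤ M → (H : Hypergraph (2 * suc M)) → Uniform H M → ∀ {ℓ} (C : BergeCycle H ℓ) →
    Hamiltonian C → ℓ ≡ 2 * suc M → ∀ {f} → f ∈ Edge H ∖ E C →
    BergePancyclic (hypergraph (E C ∪ ｛ f ｝) (E? C ∪? (f ≟ˢ_)))
  main M large H uniform C hamiltonian refl f∈E∖C =
    Unroll.pancyclic C hamiltonian f∈E∖C M uniform
      (linear (M ∷ []) λ M → goal (# 1 ⊕ (M ⊕ (# 1 ⊕ M ⊕ # 0)) ≡′ # 2 ⊕ M ⊕ M)) large
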